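{- For every (possibly partial) Boolean function $f$, $\mathsf{CG}^{\mathrm{pub}}(f)\leq O(\mathsf{EC}(f))$; that is, there is an absolute constant $C>0$ such that $\mathsf{CG}^{\mathrm{pub}}(f)\le C\cdot\mathsf{EC}(f)$ for every $n$ and every (possibly partial) Boolean function $f$ on $n$ bits.
   Context: A (possibly partial) Boolean function on $n$ bits is $f:\{0,1\}^n\to\{0,1,*\}$; its domain is $f^{ -1}(0)\cup f^{ -1}(1)$. $[n]=\{1,\dots,n\}$. Public coin certificate game complexity: one player receives $x\in f^{ -1}(0)$, the other $y\in f^{ -1}(1)$; without communication they must output a common index $i$ with $x_i\ne y_i$. A deterministic strategy is a pair $(A,B)$ with $A:f^{ -1}(0)\to[n]$, $B:f^{ -1}(1)\to[n]$; it is correct on $(x,y)$ if $A(x)=B(y)=i$ with $x_i\ne y_i$. Then $\mathsf{CG}^{\mathrm{pub}}(f)=\min_{p}\max_{x\in f^{ -1}(0),y\in f^{ -1}(1)}\Big(\sum_{(A,B)\text{ correct on }(x,y)}p_{A,B}\Big)^{ -1}$, with $p$ ranging over probability distributions on pairs $(A,B)$ of deterministic strategies. Expectational certificate complexity: $\mathsf{EC}(f)=\min_w\max_{z}\sum_{i\in[n]}w_{z,i}$, where $z$ ranges over the domain of $f$ and $w=\{w_{z,i}\}$ ranges over families of reals with $0\le w_{z,i}\le1$ satisfying $\sum_{i:z_i\neq z'_i}w_{z,i}w_{z',i}\ge1$ for all $z,z'$ in the domain with $f(z)=1-f(z')$. Conventions: $1/0=+\infty$; a maximum over an empty set (constant $f$)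 is $0$. -}

module Defs where

open import Algebra.Bundles using (CommutativeMonoid)
open import Algebra.Bundles.Raw using (RawMonoid)
import Algebra.Definitions.RawMonoid as RawMonoidDefs
import Algebra.Properties.CommutativeSemigroup as CommutativeSemigroupProperties
open import Data.Bool.Base using (Bool; true; false; not; if_then_else_)
import Data.Bool.Properties as Bool
open import Data.Fin.Base using (Fin)
import Data.Fin.Properties as Fin
open import Data.Maybe.Base using (Maybe; just)
open import Data.Nat.Base as ℕ using (ℕ)
import Data.Nat.Properties as ℕ
open import Data.Product.Base using (∃; _×_; _,_; proj₁)
open import Data.Rational.Base as ℚ using (ℚ; 0ℚ; 1ℚ; ½; ∣_∣)
import Data.Rational.Properties as ℚ
open import Data.Vec.Base using (Vec; lookup)
open import Level using (0ℓ)
open import Relation.Binary.PropositionalEquality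
  using (_≡_; _≢_; refl; sym; trans; cong; cong₂; subst)
open import Relation.Nullary.Decidable using (Dec; does; ¬?; _×-dec_)

-- Real numbers: Cauchy sequences of rationals.  The equality of reals is
-- _≈_ below, not _≡_.

IsCauchy : (ℕ → ℚ) → Set
IsCauchy s = ∀ ε → 0ℚ ℚ.< ε →
  ∃ λ N → ∀ m n → N ℕ.≤ m → N ℕ.≤ n → ∣ s m ℚ.- s n ∣ ℚ.≤ ε

record ℝ : Set where
  constructor mkℝ
  field
    seq    : ℕ → ℚ
    cauchy : IsCauchy seq

open ℝ public

infix 4 _≤_ _<_ _≈_

_≤_ : ℝ → ℝ → Set
x ≤ y = ∀ ε → 0ℚ ℚ.< ε → ∃ λ N → ∀ n → N ℕ.≤ n → seq x n ℚ.≤ seq y n ℚ.+ ε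

_<_ : ℝ → ℝ → Set
x < y = ∃ λ ε → 0ℚ ℚ.< ε × ∃ λ N → ∀ n → N ℕ.≤ n → seq x n ℚ.+ ε ℚ.≤ seq y n

_≈_ : ℝ → ℝ → Set
x ≈ y = x ≤ y × y ≤ x

fromℚ : ℚ → ℝ
fromℚ q = mkℝ (λ _ → q) λ ε 0<ε →
  0 , λ _ _ _ _ →
    subst (ℚ._≤ ε) (sym (cong ∣_∣ (ℚ.+-inverseʳ q))) (ℚ.<⇒≤ 0<ε)

0ℝ 1ℝ : ℝ
0ℝ = fromℚ 0ℚ
1ℝ = fromℚ 1ℚ

private
  halves : ∀ ε → ½ ℚ.* ε ℚ.+ ½ ℚ.* ε ≡ ε
  halves ε = trans (sym (ℚ.*-distribʳ-+ ε ½ ½)) (ℚ.*-identityˡ ε)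

  half-pos : ∀ {ε} → 0ℚ ℚ.< ε → 0ℚ ℚ.< ½ ℚ.* ε
  half-pos {ε} 0<ε =
    subst (ℚ._< ½ ℚ.* ε) (ℚ.*-zeroʳ ½) (ℚ.*-monoʳ-<-pos ½ 0<ε)

  interchange : ∀ a b c d →
    (a ℚ.+ b) ℚ.- (c ℚ.+ d) ≡ (a ℚ.- c) ℚ.+ (b ℚ.- d)
  interchange a b c d =
    trans (cong (a ℚ.+ b ℚ.+_) (ℚ.neg-distrib-+ c d))
      (medial a b (ℚ.- c) (ℚ.- d))
    where open CommutativeSemigroupProperties
           (CommutativeMonoid.commutativeSemigroup ℚ.+-0-commutativeMonoid)
            renaming (interchange to medial)

  cancel : ∀ a b → a ≡ (a ℚ.- b) ℚ.+ b
  cancel a b = sym (trans (ℚ.+-assoc a (ℚ.- b) b)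
    (trans (cong (a ℚ.+_) (ℚ.+-inverseˡ b)) (ℚ.+-identityʳ a)))

  telescope : ∀ a b c → (a ℚ.- b) ℚ.+ (b ℚ.- c) ≡ a ℚ.- c
  telescope a b c = trans (sym (ℚ.+-assoc (a ℚ.- b) b (ℚ.- c)))
    (cong (ℚ._- c) (sym (cancel a b)))

  product-difference : ∀ a b c d →
    a ℚ.* b ℚ.- c ℚ.* d ≡ a ℚ.* (b ℚ.- d) ℚ.+ d ℚ.* (a ℚ.- c)
  product-difference a b c d =
    trans (sym (telescope (a ℚ.* b) (a ℚ.* d) (c ℚ.* d)))
      (cong₂ ℚ._+_ (difference a b d)
        (trans (cong₂ ℚ._-_ (ℚ.*-comm a d) (ℚ.*-comm c d)) (difference d a c)))
    where
    difference : ∀ p q r → p ℚ.* q ℚ.- p ℚ.* r ≡ p ℚ.* (q ℚ.- r)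
    difference p q r = trans (cong (p ℚ.* q ℚ.+_) (ℚ.neg-distribʳ-* p r))
      (sym (ℚ.*-distribˡ-+ p q (ℚ.- r)))

  0<1 : 0ℚ ℚ.< 1ℚ
  0<1 = ℚ.positive⁻¹ 1ℚ

  bounded : (x : ℝ) → ∃ λ K → 0ℚ ℚ.< K ×
    ∃ λ N → ∀ n → N ℕ.≤ n → ∣ seq x n ∣ ℚ.≤ K
  bounded x with cauchy x 1ℚ 0<1
  ... | N , close =
    1ℚ ℚ.+ ∣ seq x N ∣ ,
    ℚ.+-mono-<-≤ 0<1 (ℚ.0≤∣p∣ (seq x N)) ,
    N , λ n N≤n →
      subst (λ a → ∣ a ∣ ℚ.≤ 1ℚ ℚ.+ ∣ seq x N ∣) (sym (cancel (seq x n) (seq x N)))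
        (ℚ.≤-trans (ℚ.∣p+q∣≤∣p∣+∣q∣ (seq x n ℚ.- seq x N) (seq x N))
          (ℚ.+-monoˡ-≤ ∣ seq x N ∣ (close n N N≤n ℕ.≤-refl)))

  *-bound : ∀ {K δ} a b → 0ℚ ℚ.< K → ∣ a ∣ ℚ.≤ K → ∣ b ∣ ℚ.≤ δ →
            ∣ a ℚ.* b ∣ ℚ.≤ K ℚ.* δ
  *-bound {K} {δ} a b 0<K a≤K b≤δ =
    subst (ℚ._≤ K ℚ.* δ) (sym (ℚ.∣p*q∣≡∣p∣*∣q∣ a b))
      (ℚ.≤-trans
        (ℚ.*-monoʳ-≤-nonNeg ∣ b ∣ {{ℚ.∣-∣-nonNeg b}} a≤K)
        (ℚ.*-monoˡ-≤-nonNeg K {{ℚ.nonNegative (ℚ.<⇒≤ 0<K)}} b≤δ))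

  +-close : ∀ {ε} a b c d → ∣ a ℚ.- c ∣ ℚ.≤ ½ ℚ.* ε → ∣ b ℚ.- d ∣ ℚ.≤ ½ ℚ.* ε →
            ∣ (a ℚ.+ b) ℚ.- (c ℚ.+ d) ∣ ℚ.≤ ε
  +-close {ε} a b c d a-c≤ b-d≤ = begin
    ∣ (a ℚ.+ b) ℚ.- (c ℚ.+ d) ∣
      ≡⟨ cong ∣_∣ (interchange a b c d) ⟩
    ∣ (a ℚ.- c) ℚ.+ (b ℚ.- d) ∣
      ≤⟨ ℚ.∣p+q∣≤∣p∣+∣q∣ (a ℚ.- c) (b ℚ.- d) ⟩
    ∣ a ℚ.- c ∣ ℚ.+ ∣ b ℚ.- d ∣
      ≤⟨ ℚ.+-mono-≤ a-c≤ b-d≤ ⟩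
    ½ ℚ.* ε ℚ.+ ½ ℚ.* ε
      ≡⟨ halves ε ⟩
    ε ∎
    where open ℚ.≤-Reasoning

  *-close : ∀ {K L δ ε} a b c d → 0ℚ ℚ.< K → 0ℚ ℚ.< L → (K ℚ.+ L) ℚ.* δ ≡ ε →
            ∣ a ∣ ℚ.≤ K → ∣ d ∣ ℚ.≤ L → ∣ a ℚ.- c ∣ ℚ.≤ δ → ∣ b ℚ.- d ∣ ℚ.≤ δ →
            ∣ a ℚ.* b ℚ.- c ℚ.* d ∣ ℚ.≤ ε
  *-close {K} {L} {δ} {ε} a b c d 0<K 0<L [K+L]δ≡ε a≤K d≤L a-c≤δ b-d≤δ = begin
    ∣ a ℚ.* b ℚ.- c ℚ.* d ∣
      ≡⟨ cong ∣_∣ (product-difference a b c d) ⟩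
    ∣ a ℚ.* (b ℚ.- d) ℚ.+ d ℚ.* (a ℚ.- c) ∣
      ≤⟨ ℚ.∣p+q∣≤∣p∣+∣q∣ (a ℚ.* (b ℚ.- d)) (d ℚ.* (a ℚ.- c)) ⟩
    ∣ a ℚ.* (b ℚ.- d) ∣ ℚ.+ ∣ d ℚ.* (a ℚ.- c) ∣
      ≤⟨ ℚ.+-mono-≤ (*-bound a (b ℚ.- d) 0<K a≤K b-d≤δ)
                    (*-bound d (a ℚ.- c) 0<L d≤L a-c≤δ) ⟩
    K ℚ.* δ ℚ.+ L ℚ.* δ
      ≡⟨ ℚ.*-distribʳ-+ δ K L ⟨
    (K ℚ.+ L) ℚ.* δ
      ≡⟨ [K+L]δ≡ε ⟩
    ε ∎
    where open ℚ.≤-Reasoning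

  divide : ∀ {K ε} → 0ℚ ℚ.< K → 0ℚ ℚ.< ε → ∃ λ δ → 0ℚ ℚ.< δ × K ℚ.* δ ≡ ε
  divide {K} {ε} 0<K 0<ε =
    1/K ℚ.* ε ,
    ℚ.positive⁻¹ _ {{ℚ.pos*pos⇒pos 1/K {{ℚ.1/pos⇒pos K}} ε {{ℚ.positive 0<ε}}}} ,
    trans (sym (ℚ.*-assoc K 1/K ε))
      (trans (cong (ℚ._* ε) (ℚ.*-inverseʳ K)) (ℚ.*-identityˡ ε))
    where
    instance
      K-pos : ℚ.Positive K
      K-pos = ℚ.positive 0<K
      K-nonZero : ℚ.NonZero K
      K-nonZero = ℚ.pos⇒nonZero K
    1/K = ℚ.1/ K

  abstract
    +-cauchy : ∀ x y → IsCauchy (λ n → seq x n ℚ.+ seq y n)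
    +-cauchy x y ε 0<ε =
      let M , x-close = cauchy x (½ ℚ.* ε) (half-pos 0<ε)
          N , y-close = cauchy y (½ ℚ.* ε) (half-pos 0<ε)
      in M ℕ.⊔ N , λ m n m≥ n≥ →
        +-close (seq x m) (seq y m) (seq x n) (seq y n)
          (x-close m n (ℕ.m⊔n≤o⇒m≤o M N m≥) (ℕ.m⊔n≤o⇒m≤o M N n≥))
          (y-close m n (ℕ.m⊔n≤o⇒n≤o M N m≥) (ℕ.m⊔n≤o⇒n≤o M N n≥))

    *-cauchy : ∀ x y → IsCauchy (λ n → seq x n ℚ.* seq y n)
    *-cauchy x y ε 0<ε =
      let K , 0<K , N₁ , x≤K = bounded x
          L , 0<L , N₂ , y≤L = bounded y
          δ , 0<δ , [K+L]δ≡ε = divide (ℚ.+-mono-< 0<K 0<L) 0<ε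
          N₃ , x-close = cauchy x δ 0<δ
          N₄ , y-close = cauchy y δ 0<δ
          N₁₂ = N₁ ℕ.⊔ N₂
          N₃₄ = N₃ ℕ.⊔ N₄
      in N₁₂ ℕ.⊔ N₃₄ , λ m n m≥ n≥ →
        let m≥₁₂ = ℕ.m⊔n≤o⇒m≤o N₁₂ N₃₄ m≥
            n≥₁₂ = ℕ.m⊔n≤o⇒m≤o N₁₂ N₃₄ n≥
            m≥₃₄ = ℕ.m⊔n≤o⇒n≤o N₁₂ N₃₄ m≥
            n≥₃₄ = ℕ.m⊔n≤o⇒n≤o N₁₂ N₃₄ n≥
        in *-close (seq x m) (seq y m) (seq x n) (seq y n) 0<K 0<L [K+L]δ≡ε
             (x≤K m (ℕ.m⊔n≤o⇒m≤o N₁ N₂ m≥₁₂))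
             (y≤L n (ℕ.m⊔n≤o⇒n≤o N₁ N₂ n≥₁₂))
             (x-close m n (ℕ.m⊔n≤o⇒m≤o N₃ N₄ m≥₃₄) (ℕ.m⊔n≤o⇒m≤o N₃ N₄ n≥₃₄))
             (y-close m n (ℕ.m⊔n≤o⇒n≤o N₃ N₄ m≥₃₄) (ℕ.m⊔n≤o⇒n≤o N₃ N₄ n≥₃₄))

infixl 6 _+_
infixl 7 _*_

_+_ : ℝ → ℝ → ℝ
x + y = mkℝ (λ n → seq x n ℚ.+ seq y n) (+-cauchy x y)

_*_ : ℝ → ℝ → ℝ
x * y = mkℝ (λ n → seq x n ℚ.* seq y n) (*-cauchy x y)

+-rawMonoid : RawMonoid 0ℓ 0ℓ
+-rawMonoid = record { Carrier = ℝ ; _≈_ = _≈_ ; _∙_ = _+_ ; ε = 0ℝ }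

open RawMonoidDefs +-rawMonoid public using (sum)

-- sum (λ i → when (P? i) (t i)) is the sum of the t i over those i with P i.

when : ∀ {P : Set} → Dec P → ℝ → ℝ
when P? x = if does P? then x else 0ℝ

-- Values in [0,+∞], presented by the set of their real upper bounds: u r means
-- "u is at most r".  The set of bounds of c ∈ [0,+∞) is { r ∣ c ≤ r }, and that
-- of +∞ is empty.

[0,∞] : Set₁
[0,∞] = ℝ → Set

infix 4 _≤∞_

_≤∞_ : [0,∞] → [0,∞] → Set
u ≤∞ v = ∀ r → v r → u r

-- For x ≥ 0.

finite : ℝ → [0,∞]
finite x r = x ≤ r

-- For x ≥ 0.  Nothing satisfies 1 ≤ r * 0, so 1/0 = +∞.

infix 8 _⁻¹

_⁻¹ : ℝ → [0,∞]
(x ⁻¹) r = 1ℝ ≤ r * x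

-- For C > 0.

infixr 7 _·_

_·_ : ℝ → [0,∞] → [0,∞]
(C · u) r = ∃ λ s → u s × C * s ≤ r

-- The conjunct 0 ≤ r makes the maximum of the empty family 0.

max : (I : Set) → (I → [0,∞]) → [0,∞]
max I u r = 0ℝ ≤ r × (∀ i → u i r)

-- An attained minimum is at most r exactly when some member is; the minimum
-- of the empty family is +∞.

min : (I : Set) → (I → [0,∞]) → [0,∞]
min I u r = ∃ λ i → u i r

-- Partial Boolean functions; nothing plays the role of *.

BoolFn : ℕ → Set
BoolFn n = Vec Bool n → Maybe Bool

module _ {n : ℕ} (f : BoolFn n) where

  Preimage : Bool → Set
  Preimage b = ∃ λ z → f z ≡ just b

  Domain : Set
  Domain = ∃ λ b → Preimage b

bits : ∀ {n} {f : BoolFn n} → Domain f → Vec Bool n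
bits (_ , z , _) = z

value : ∀ {n} {f : BoolFn n} → Domain f → Bool
value (b , _ , _) = b

differ? : ∀ {n} (x y : Vec Bool n) (i : Fin n) → Dec (lookup x i ≢ lookup y i)
differ? x y i = ¬? (lookup x i Bool.≟ lookup y i)

-- Probability distributions of finite support, as a finite list of weighted
-- points.  A point may be listed several times, its probability being the total
-- of its weights.  Since there are finitely many deterministic strategies, this
-- covers all distributions on them.

record Distribution (S : Set) : Set where
  field
    size   : ℕ
    point  : Fin size → S
    weight : Fin size → ℝ
    nonneg : ∀ k → 0ℝ ≤ weight k
    total  : sum weight ≈ 1ℝ

probability : ∀ {S : Set} (p : Distribution S) {E : S → Set} →
              (∀ s → Dec (E s)) → ℝ
probability p E? = sum λ k → when (E? (point k)) (weight k)
  where open Distribution p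

module _ {n : ℕ} (f : BoolFn n) where

  Strategy : Set
  Strategy = (Preimage f false → Fin n) × (Preimage f true → Fin n)

  Correct : Preimage f false → Preimage f true → Strategy → Set
  Correct x y (A , B) =
    A x ≡ B y × lookup (proj₁ x) (A x) ≢ lookup (proj₁ y) (A x)

  correct? : ∀ x y s → Dec (Correct x y s)
  correct? x y (A , B) =
    (A x Fin.≟ B y) ×-dec differ? (proj₁ x) (proj₁ y) (A x)

  CGpub : [0,∞]
  CGpub =
    min (Distribution Strategy) λ p →
    max (Preimage f false × Preimage f true) λ (x , y) →
    probability p (correct? x y) ⁻¹

  record Weights : Set where
    field
      w      : Domain f → Fin n → ℝ
      0≤w    : ∀ z i → 0ℝ ≤ w z i
      w≤1    : ∀ z i → w z i ≤ 1ℝ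
      covers : ∀ z z′ → value z ≡ not (value z′) →
               1ℝ ≤ sum λ i → when (differ? (bits z) (bits z′) i) (w z i * w z′ i)

  EC : [0,∞]
  EC =
    min Weights λ W →
    max (Domain f) λ z →
    finite (sum (Weights.w W z))

{-# OPTIONS --safe #-}
-- Correlated sampling.  Round the weights up to multiples a/M of 1/M, where M is
-- a multiple of n, and publish a random word over the cells (i , t) with t < 2M.
-- A player holding z answers the index i of the first letter with t < a z i.
-- Given x and y, the first letter in the union of the two sets of cells lies in
-- their intersection, in a column where x and y differ, with probability at
-- least Σᵢ min (a x i) (a y i) / (Σᵢ a x i + Σᵢ a y i).  Here
-- min (a x i) (a y i) ≥ a x i · a y i / 2M, so the covering condition makes the
-- numerator of order M, while the denominator is of order M · EC.  Finitely
-- many letters suffice: as many as there are cells.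
module Submission where

open import Defs
open import Data.Nat.Base using (ℕ; NonZero)
open import Data.Product.Base using (∃; _×_)

open import Algebra.Bundles using (CommutativeRing)
import Algebra.Properties.Semiring.Mult as SemiringMult
import Algebra.Properties.Semiring.Sum as SemiringSum
open import Data.Bool.Base using (Bool; true; false; if_then_else_; _∧_; T)
open import Data.Fin.Base as Fin using (Fin)
import Data.Fin.Properties as Fin
open import Data.List.Base
  using (List; []; _∷_; _++_; length; lookup; map; allFin; tabulate; cartesianProductWith; downFrom)
open import Data.List.Properties
  using (length-++; length-downFrom; length-map; length-tabulate; tabulate-lookup)
open import Data.Nat.Base as ℕ using (_<ᵇ_)
import Data.Nat.Properties as ℕ
open import Data.Nat.Solver using () renaming (module +-*-Solver to ℕ-Solver)
open import Data.Product.Base using (_,_; proj₁; proj₂)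
open import Data.Rational.Base as ℚ using (ℚ; 0ℚ; 1ℚ; ½; ∣_∣)
import Data.Rational.Properties as ℚ
open import Data.Rational.Solver using (module +-*-Solver)
open import Data.Sum.Base using (_⊎_; inj₁; inj₂)
open import Function.Base using (_∘_; id)
open import Relation.Binary.PropositionalEquality
  using (_≡_; refl; sym; trans; cong; cong₂; subst; subst₂; module ≡-Reasoning)
open import Relation.Nullary.Decidable using (Dec; does; dec-true; _×-dec_)

ℚ-semiring = CommutativeRing.semiring ℚ.+-*-commutativeRing
module ℕΣ = SemiringSum ℕ.+-*-semiring
module ℚΣ = SemiringSum ℚ-semiring
module ℚ× = SemiringMult ℚ-semiring

private variable
  A B C I : Set

-- Finite sums of naturals over lists.

𝟙 : Bool → ℕ
𝟙 b = if b then 1 else 0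

∑ : List A → (A → ℕ) → ℕ
∑ []       f = 0
∑ (x ∷ xs) f = f x ℕ.+ ∑ xs f

∑-mono : ∀ (xs : List A) {f g : A → ℕ} → (∀ x → f x ℕ.≤ g x) → ∑ xs f ℕ.≤ ∑ xs g
∑-mono []       f≤g = ℕ.z≤n
∑-mono (x ∷ xs) f≤g = ℕ.+-mono-≤ (f≤g x) (∑-mono xs f≤g)

∑-cong : ∀ (xs : List A) {f g : A → ℕ} → (∀ x → f x ≡ g x) → ∑ xs f ≡ ∑ xs g
∑-cong []       f≡g = refl
∑-cong (x ∷ xs) f≡g = cong₂ ℕ._+_ (f≡g x) (∑-cong xs f≡g)

∑-distrib-+ : ∀ (xs : List A) (f g : A → ℕ) → ∑ xs (λ x → f x ℕ.+ g x) ≡ ∑ xs f ℕ.+ ∑ xs g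
∑-distrib-+ []       f g = refl
∑-distrib-+ (x ∷ xs) f g rewrite ∑-distrib-+ xs f g =
  solve 4 (λ a b c d → (a :+ b) :+ (c :+ d) := (a :+ c) :+ (b :+ d)) refl (f x) (g x) (∑ xs f) (∑ xs g)
  where open ℕ-Solver

∑-distribʳ-* : ∀ (xs : List A) (f : A → ℕ) k → ∑ xs (λ x → f x ℕ.* k) ≡ ∑ xs f ℕ.* k
∑-distribʳ-* []       f k = refl
∑-distribʳ-* (x ∷ xs) f k rewrite ∑-distribʳ-* xs f k = sym (ℕ.*-distribʳ-+ k (f x) (∑ xs f))

∑-1 : ∀ (xs : List A) → ∑ xs (λ _ → 1) ≡ length xs
∑-1 []       = refl
∑-1 (_ ∷ xs) = cong ℕ.suc (∑-1 xs)

∑-++ : ∀ (xs ys : List A) (f : A → ℕ) → ∑ (xs ++ ys) f ≡ ∑ xs f ℕ.+ ∑ ys f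
∑-++ []       ys f = refl
∑-++ (x ∷ xs) ys f rewrite ∑-++ xs ys f = sym (ℕ.+-assoc (f x) (∑ xs f) (∑ ys f))

∑-map : ∀ (g : A → B) xs (f : B → ℕ) → ∑ (map g xs) f ≡ ∑ xs (f ∘ g)
∑-map g []       f = refl
∑-map g (x ∷ xs) f = cong (f (g x) ℕ.+_) (∑-map g xs f)

∑-cartesianProductWith : ∀ (g : A → B → C) xs ys (f : C → ℕ) →
  ∑ (cartesianProductWith g xs ys) f ≡ ∑ xs λ x → ∑ ys λ y → f (g x y)
∑-cartesianProductWith g []       ys f = refl
∑-cartesianProductWith g (x ∷ xs) ys f = trans
  (∑-++ (map (g x) ys) (cartesianProductWith g xs ys) f)
  (cong₂ ℕ._+_ (∑-map (g x) ys f) (∑-cartesianProductWith g xs ys f))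

∑-tabulate : ∀ {n} (g : Fin n → A) (f : A → ℕ) → ∑ (tabulate g) f ≡ ℕΣ.sum (f ∘ g)
∑-tabulate {n = ℕ.zero}  g f = refl
∑-tabulate {n = ℕ.suc n} g f = cong (f (g Fin.zero) ℕ.+_) (∑-tabulate (g ∘ Fin.suc) f)

∑-lookup : ∀ (xs : List A) (f : A → ℕ) → ℕΣ.sum (f ∘ lookup xs) ≡ ∑ xs f
∑-lookup xs f = trans (sym (∑-tabulate (lookup xs) f)) (cong (λ l → ∑ l f) (tabulate-lookup xs))

length-cartesianProductWith : ∀ (g : A → B → C) xs ys →
  length (cartesianProductWith g xs ys) ≡ length xs ℕ.* length ys
length-cartesianProductWith g []       ys = refl
length-cartesianProductWith g (x ∷ xs) ys = trans
  (length-++ (map (g x) ys))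
  (cong₂ ℕ._+_ (length-map (g x) ys) (length-cartesianProductWith g xs ys))

-- Random words and the first accepted letter.

words : List A → ℕ → List (List A)
words letters ℕ.zero    = [] ∷ []
words letters (ℕ.suc T) = cartesianProductWith _∷_ letters (words letters T)

length-words : ∀ (letters : List A) T → length (words letters T) ≡ length letters ℕ.^ T
length-words letters ℕ.zero    = refl
length-words letters (ℕ.suc T) = trans
  (length-cartesianProductWith _∷_ letters (words letters T))
  (cong (length letters ℕ.*_) (length-words letters T))

module _ (index : A → I) (default : I) where

  first : (A → Bool) → List A → I
  first p []       = default
  first p (c ∷ w) = if p c then index c else first p w

  module _ (letters : List A) (p q : A → Bool) (h : I → I → ℕ) where

    -- With `h` the indicator of a correct pair of answers, this is the number of words of length
    -- `T` on which the two players succeed.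
    hits : ℕ → ℕ
    hits T = ∑ (words letters T) λ w → h (first p w) (first q w)

    -- For such an `h`, the number of letters that end the game at once with success: both players
    -- accept and the common answer is correct.
    agreement : ℕ
    agreement = ∑ letters λ c → 𝟙 (p c) ℕ.* 𝟙 (q c) ℕ.* h (index c) (index c)

    private
      N X Y V : ℕ
      N = length letters
      X = ∑ letters (𝟙 ∘ p)
      Y = ∑ letters (𝟙 ∘ q)
      V = ∑ letters λ c → 𝟙 (if p c then false else if q c then false else true)

    -- Union bound: `V` counts the letters rejected by both players, and every other letter is
    -- counted in `X` or in `Y`.
    missed : N ℕ.≤ V ℕ.+ (X ℕ.+ Y)
    missed = begin
      N                                                ≡⟨ ∑-1 letters ⟨
      ∑ letters (λ _ → 1)                              ≤⟨ ∑-mono letters covered ⟩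
      ∑ letters (λ c → v c ℕ.+ (𝟙 (p c) ℕ.+ 𝟙 (q c)))  ≡⟨ ∑-distrib-+ letters v (λ c → 𝟙 (p c) ℕ.+ 𝟙 (q c)) ⟩
      V ℕ.+ ∑ letters (λ c → 𝟙 (p c) ℕ.+ 𝟙 (q c))      ≡⟨ cong (V ℕ.+_) (∑-distrib-+ letters (𝟙 ∘ p) (𝟙 ∘ q)) ⟩
      V ℕ.+ (X ℕ.+ Y)                                  ∎
      where
      open ℕ.≤-Reasoning
      v : A → ℕ
      v c = 𝟙 (if p c then false else if q c then false else true)
      covered : ∀ c → 1 ℕ.≤ v c ℕ.+ (𝟙 (p c) ℕ.+ 𝟙 (q c))
      covered c with p c | q c
      ... | true  | _     = ℕ.s≤s ℕ.z≤n
      ... | false | true  = ℕ.s≤s ℕ.z≤n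
      ... | false | false = ℕ.s≤s ℕ.z≤n

    -- Condition on the first letter. If both players accept it, all `N ^ T` continuations give the
    -- same answers; if both reject it, the game restarts on the remaining `T` letters. Letters
    -- accepted by exactly one player are estimated by zero, whence the inequality.
    hits-step : ∀ T → agreement ℕ.* N ℕ.^ T ℕ.+ V ℕ.* hits T ℕ.≤ hits (ℕ.suc T)
    hits-step T = begin
      agreement ℕ.* N ℕ.^ T ℕ.+ V ℕ.* hits T
        ≡⟨ cong₂ ℕ._+_ (∑-distribʳ-* letters _ (N ℕ.^ T)) (∑-distribʳ-* letters _ (hits T)) ⟨
      ∑ letters _ ℕ.+ ∑ letters _
        ≡⟨ ∑-distrib-+ letters _ _ ⟨
      ∑ letters _
        ≤⟨ ∑-mono letters by-first-letter ⟩
      ∑ letters (λ c → ∑ (words letters T) λ w → h (first p (c ∷ w)) (first q (c ∷ w)))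
        ≡⟨ ∑-cartesianProductWith _∷_ letters (words letters T) _ ⟨
      hits (ℕ.suc T) ∎
      where
      open ℕ.≤-Reasoning
      by-first-letter : ∀ c →
        𝟙 (p c) ℕ.* 𝟙 (q c) ℕ.* h (index c) (index c) ℕ.* N ℕ.^ T
          ℕ.+ 𝟙 (if p c then false else if q c then false else true) ℕ.* hits T
        ℕ.≤ ∑ (words letters T) λ w → h (first p (c ∷ w)) (first q (c ∷ w))
      by-first-letter c with p c | q c
      ... | true  | true  = ℕ.≤-reflexive (begin-equality
        (h i i ℕ.+ 0) ℕ.* N ℕ.^ T ℕ.+ 0          ≡⟨ solve 2 (λ a b → (a :+ con 0) :* b :+ con 0 := b :* a) refl (h i i) (N ℕ.^ T) ⟩
        N ℕ.^ T ℕ.* h i i                        ≡⟨ cong (ℕ._* h i i) (trans (∑-1 (words letters T)) (length-words letters T)) ⟨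
        ∑ (words letters T) (λ _ → 1) ℕ.* h i i  ≡⟨ ∑-distribʳ-* (words letters T) (λ _ → 1) (h i i) ⟨
        ∑ (words letters T) (λ _ → 1 ℕ.* h i i)  ≡⟨ ∑-cong (words letters T) (λ _ → ℕ.*-identityˡ (h i i)) ⟩
        ∑ (words letters T) (λ _ → h i i)        ∎)
        where
        open ℕ-Solver
        i = index c
      ... | true  | false = ℕ.z≤n
      ... | false | true  = ℕ.z≤n
      ... | false | false = ℕ.≤-reflexive (ℕ.*-identityˡ (hits T))

    -- The sharp bound D/U · (1 − (1 − U/N)ᵀ) on the success probability of T
    -- letters dominates D·T / (N + T·U), which is stable under the recursion.
    hits-bound : ∀ T → agreement ℕ.* T ℕ.* N ℕ.^ T ℕ.≤ hits T ℕ.* (N ℕ.+ T ℕ.* (X ℕ.+ Y))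
    hits-bound ℕ.zero    rewrite ℕ.*-zeroʳ agreement = ℕ.z≤n
    hits-bound (ℕ.suc T) = begin
      D ℕ.* ℕ.suc T ℕ.* (N ℕ.* L)
        ≡⟨ solve 4 (λ d t n l → d :* (con 1 :+ t) :* (n :* l) := d :* l :* (n :+ t :* n)) refl D T N L ⟩
      D ℕ.* L ℕ.* (N ℕ.+ T ℕ.* N)
        -- Only the factor `N` multiplied by `T` is split along `missed`; its part with `V` becomes
        -- `V` times the left side of the induction hypothesis.
        ≤⟨ ℕ.*-monoʳ-≤ (D ℕ.* L) (ℕ.+-monoʳ-≤ N (ℕ.*-monoʳ-≤ T missed)) ⟩
      D ℕ.* L ℕ.* (N ℕ.+ T ℕ.* (V ℕ.+ U))
        ≡⟨ solve 6 (λ d l n t v u → d :* l :* (n :+ t :* (v :+ u)) :=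
                                    d :* l :* (n :+ t :* u) :+ v :* (d :* t :* l)) refl D L N T V U ⟩
      D ℕ.* L ℕ.* (N ℕ.+ T ℕ.* U) ℕ.+ V ℕ.* (D ℕ.* T ℕ.* L)
        ≤⟨ ℕ.+-monoʳ-≤ _ (ℕ.*-monoʳ-≤ V (hits-bound T)) ⟩
      D ℕ.* L ℕ.* (N ℕ.+ T ℕ.* U) ℕ.+ V ℕ.* (hits T ℕ.* (N ℕ.+ T ℕ.* U))
        ≡⟨ solve 4 (λ a v b e → a :* e :+ v :* (b :* e) := (a :+ v :* b) :* e) refl (D ℕ.* L) V (hits T) (N ℕ.+ T ℕ.* U) ⟩
      (D ℕ.* L ℕ.+ V ℕ.* hits T) ℕ.* (N ℕ.+ T ℕ.* U)
        ≤⟨ ℕ.*-mono-≤ (hits-step T) (ℕ.+-monoʳ-≤ N (ℕ.m≤n+m (T ℕ.* U) U)) ⟩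
      hits (ℕ.suc T) ℕ.* (N ℕ.+ ℕ.suc T ℕ.* U) ∎
      where
      open ℕ.≤-Reasoning
      open ℕ-Solver
      D = agreement
      L = N ℕ.^ T
      U = X ℕ.+ Y

    -- At `T = N` the denominator is `N * (1 + U)` and `N` cancels: the success probability is at
    -- least `D / (1 + U)`, close to the limit `D / U` of the sharp bound for long words.
    hits-length : .{{_ : NonZero N}} → agreement ℕ.* N ℕ.^ N ℕ.≤ hits N ℕ.* (1 ℕ.+ (X ℕ.+ Y))
    hits-length = ℕ.*-cancelˡ-≤ N (begin
      N ℕ.* (D ℕ.* N ℕ.^ N)         ≡⟨ solve 3 (λ n d l → n :* (d :* l) := d :* n :* l) refl N D (N ℕ.^ N) ⟩
      D ℕ.* N ℕ.* N ℕ.^ N           ≤⟨ hits-bound N ⟩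
      hits N ℕ.* (N ℕ.+ N ℕ.* U)    ≡⟨ solve 3 (λ h n u → h :* (n :+ n :* u) := n :* (h :* (con 1 :+ u))) refl (hits N) N U ⟩
      N ℕ.* (hits N ℕ.* (1 ℕ.+ U))  ∎)
      where
      open ℕ.≤-Reasoning
      open ℕ-Solver
      D = agreement
      U = X ℕ.+ Y

-- Counting the cells of one column.

∑-<ᵇ-upper : ∀ K a → ∑ (downFrom K) (λ t → 𝟙 (t <ᵇ a)) ℕ.≤ a
∑-<ᵇ-upper K a = ℕ.≤-trans (go K) (ℕ.m⊓n≤n K a)
  where
  -- The minimum carries the induction: when `K` itself is counted, the smaller values must be
  -- bounded by `K`, not by `a`.
  go : ∀ K → ∑ (downFrom K) (λ t → 𝟙 (t <ᵇ a)) ℕ.≤ K ℕ.⊓ a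
  go ℕ.zero    = ℕ.z≤n
  go (ℕ.suc K) with K <ᵇ a in eq
  ... | true  rewrite ℕ.m≤n⇒m⊓n≡m (ℕ.<ᵇ⇒< K a (subst T (sym eq) _)) =
    ℕ.s≤s (ℕ.≤-trans (go K) (ℕ.m⊓n≤m K a))
  ... | false = ℕ.≤-trans (go K) (ℕ.⊓-monoˡ-≤ a (ℕ.n≤1+n K))

-- A product is minimum times maximum; the sum counts at least the minimum, and the maximum is at
-- most `K`.
*≤∑-<ᵇ : ∀ K {a b} → a ℕ.≤ K → b ℕ.≤ K →
  a ℕ.* b ℕ.≤ ∑ (downFrom K) (λ t → 𝟙 (t <ᵇ a) ℕ.* 𝟙 (t <ᵇ b)) ℕ.* K
*≤∑-<ᵇ K {a} {b} a≤K b≤K = ℕ.≤-trans (ℕ.≤-reflexive ab≡) (ℕ.*-mono-≤ min≤ (ℕ.⊔-lub a≤K b≤K))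
  where
  ab≡ : a ℕ.* b ≡ (a ℕ.⊓ b) ℕ.* (a ℕ.⊔ b)
  ab≡ with ℕ.≤-total a b
  ... | inj₁ a≤b rewrite ℕ.m≤n⇒m⊓n≡m a≤b | ℕ.m≤n⇒m⊔n≡n a≤b = refl
  ... | inj₂ b≤a rewrite ℕ.m≥n⇒m⊓n≡n b≤a | ℕ.m≥n⇒m⊔n≡m b≤a = ℕ.*-comm a b
  𝟙-< : ∀ {t c} → t ℕ.< c → 𝟙 (t <ᵇ c) ≡ 1
  𝟙-< {t} {c} t<c with t <ᵇ c | ℕ.<⇒<ᵇ t<c
  ... | true | _ = refl
  -- Replacing the minimum by any common lower bound `m` lets `m` shrink together with `J` once `m`
  -- equals the length of the range.
  go : ∀ J m → m ℕ.≤ J → m ℕ.≤ a → m ℕ.≤ b → m ℕ.≤ ∑ (downFrom J) (λ t → 𝟙 (t <ᵇ a) ℕ.* 𝟙 (t <ᵇ b))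
  go ℕ.zero    m m≤0 _ _ = m≤0
  go (ℕ.suc J) m m≤1+J m≤a m≤b with ℕ.m≤n⇒m<n∨m≡n m≤1+J
  ... | inj₁ (ℕ.s≤s m≤J) = ℕ.≤-trans (go J m m≤J m≤a m≤b) (ℕ.m≤n+m _ (𝟙 (J <ᵇ a) ℕ.* 𝟙 (J <ᵇ b)))
  ... | inj₂ refl rewrite 𝟙-< m≤a | 𝟙-< m≤b = ℕ.s≤s (go J J ℕ.≤-refl (ℕ.<⇒≤ m≤a) (ℕ.<⇒≤ m≤b))
  min≤ : a ℕ.⊓ b ℕ.≤ ∑ (downFrom K) (λ t → 𝟙 (t <ᵇ a) ℕ.* 𝟙 (t <ᵇ b))
  min≤ = go K (a ℕ.⊓ b) (ℕ.≤-trans (ℕ.m⊓n≤m a b) a≤K) (ℕ.m⊓n≤m a b) (ℕ.m⊓n≤n a b)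

-- Naturals inside the rationals, and rational inequalities.

abstract
  -- Opaque outside this block, so that constants such as `ι 56` are handled only through the
  -- homomorphism laws.
  ι : ℕ → ℚ
  ι n = n ℚ×.× 1ℚ

  ι-0 : ι 0 ≡ 0ℚ
  ι-0 = refl

  ι-suc : ∀ n → ι (ℕ.suc n) ≡ 1ℚ ℚ.+ ι n
  ι-suc n = refl

  ι-+ : ∀ m n → ι (m ℕ.+ n) ≡ ι m ℚ.+ ι n
  ι-+ = ℚ×.×-homo-+ 1ℚ

  ι-* : ∀ m n → ι (m ℕ.* n) ≡ ι m ℚ.* ι n
  ι-* = ℚ×.×1-homo-*

ι-1 : ι 1 ≡ 1ℚ
ι-1 = trans (ι-suc 0) (cong (1ℚ ℚ.+_) ι-0)

0≤1 : 0ℚ ℚ.≤ 1ℚ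
0≤1 = ℚ.nonNegative⁻¹ 1ℚ

0≤ι : ∀ n → 0ℚ ℚ.≤ ι n
0≤ι ℕ.zero    = ℚ.≤-reflexive (sym ι-0)
0≤ι (ℕ.suc n) = subst (0ℚ ℚ.≤_) (sym (ι-suc n)) (ℚ.+-mono-≤ 0≤1 (0≤ι n))

ι-mono-≤ : ∀ {m n} → m ℕ.≤ n → ι m ℚ.≤ ι n
ι-mono-≤ {m} {n} m≤n = begin
  ι m                  ≡⟨ ℚ.+-identityʳ (ι m) ⟨
  ι m ℚ.+ 0ℚ           ≤⟨ ℚ.+-monoʳ-≤ (ι m) (0≤ι (n ℕ.∸ m)) ⟩
  ι m ℚ.+ ι (n ℕ.∸ m)  ≡⟨ ι-+ m (n ℕ.∸ m) ⟨
  ι (m ℕ.+ (n ℕ.∸ m))  ≡⟨ cong ι (ℕ.m+[n∸m]≡n m≤n) ⟩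
  ι n                  ∎
  where open ℚ.≤-Reasoning

ι-mono-< : ∀ {m n} → m ℕ.< n → ι m ℚ.< ι n
ι-mono-< {m} {n} m<n = begin-strict
  ι m          ≡⟨ ℚ.+-identityˡ (ι m) ⟨
  0ℚ ℚ.+ ι m   <⟨ ℚ.+-monoˡ-< (ι m) (ℚ.positive⁻¹ 1ℚ) ⟩
  1ℚ ℚ.+ ι m   ≡⟨ ι-suc m ⟨
  ι (ℕ.suc m)  ≤⟨ ι-mono-≤ m<n ⟩
  ι n          ∎
  where open ℚ.≤-Reasoning

ι-cancel-≤ : ∀ {m n} → ι m ℚ.≤ ι n → m ℕ.≤ n
ι-cancel-≤ ιm≤ιn = ℕ.≮⇒≥ λ n<m → ℚ.<-irrefl refl (ℚ.<-≤-trans (ι-mono-< n<m) ιm≤ιn)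

ι-sum : ∀ {n} (t : Fin n → ℕ) → ι (ℕΣ.sum t) ≡ ℚΣ.sum (ι ∘ t)
ι-sum {ℕ.zero}  t = ι-0
ι-sum {ℕ.suc n} t = trans (ι-+ (t Fin.zero) _) (cong (ι (t Fin.zero) ℚ.+_) (ι-sum (t ∘ Fin.suc)))

ι⁻¹ : ∀ n .{{_ : NonZero n}} → ∃ λ u → 0ℚ ℚ.< u × ι n ℚ.* u ≡ 1ℚ
ι⁻¹ n@(ℕ.suc _) =
  ℚ.1/ ι n , ℚ.positive⁻¹ _ {{ℚ.1/pos⇒pos (ι n)}} , ℚ.*-inverseʳ (ι n)
  where
  instance
    ιn-pos : ℚ.Positive (ι n)
    ιn-pos = ℚ.positive (subst (ℚ._< ι n) ι-0 (ι-mono-< (ℕ.s≤s ℕ.z≤n)))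
    ιn-nonZero : ℚ.NonZero (ι n)
    ιn-nonZero = ℚ.pos⇒nonZero (ι n)

0≤p*q : ∀ {p q} → 0ℚ ℚ.≤ p → 0ℚ ℚ.≤ q → 0ℚ ℚ.≤ p ℚ.* q
0≤p*q {p} {q} 0≤p 0≤q = ℚ.nonNegative⁻¹ _
  {{ℚ.nonNeg*nonNeg⇒nonNeg p {{ℚ.nonNegative 0≤p}} q {{ℚ.nonNegative 0≤q}}}}

*-monoˡ : ∀ {p q r} → 0ℚ ℚ.≤ r → p ℚ.≤ q → r ℚ.* p ℚ.≤ r ℚ.* q
*-monoˡ {r = r} 0≤r = ℚ.*-monoˡ-≤-nonNeg r {{ℚ.nonNegative 0≤r}}

*-monoʳ : ∀ {p q r} → 0ℚ ℚ.≤ r → p ℚ.≤ q → p ℚ.* r ℚ.≤ q ℚ.* r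
*-monoʳ {r = r} 0≤r = ℚ.*-monoʳ-≤-nonNeg r {{ℚ.nonNegative 0≤r}}

p≤∣p∣ : ∀ p → p ℚ.≤ ∣ p ∣
p≤∣p∣ p with ℚ.≤-total 0ℚ p
... | inj₁ 0≤p = ℚ.≤-reflexive (sym (ℚ.0≤p⇒∣p∣≡p 0≤p))
... | inj₂ p≤0 = ℚ.≤-trans p≤0 (ℚ.0≤∣p∣ p)

∣p∣≤ : ∀ {p q} → p ℚ.≤ q → ℚ.- p ℚ.≤ q → ∣ p ∣ ℚ.≤ q
∣p∣≤ {p} {q} p≤q -p≤q with ℚ.∣p∣≡p∨∣p∣≡-p p
... | inj₁ eq = subst (ℚ._≤ q) (sym eq) p≤q
... | inj₂ eq = subst (ℚ._≤ q) (sym eq) -p≤q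

p-q≤r⇒p≤q+r : ∀ p q {r} → p ℚ.- q ℚ.≤ r → p ℚ.≤ q ℚ.+ r
p-q≤r⇒p≤q+r p q {r} p-q≤r = subst (ℚ._≤ q ℚ.+ r)
  (solve 2 (λ p q → q :+ (p :- q) := p) refl p q)
  (ℚ.+-monoʳ-≤ q p-q≤r)
  where open +-*-Solver

ℚsum-mono : ∀ {n} {s t : Fin n → ℚ} → (∀ i → s i ℚ.≤ t i) → ℚΣ.sum s ℚ.≤ ℚΣ.sum t
ℚsum-mono {ℕ.zero}  s≤t = ℚ.≤-refl
ℚsum-mono {ℕ.suc n} s≤t = ℚ.+-mono-≤ (s≤t Fin.zero) (ℚsum-mono (s≤t ∘ Fin.suc))

seq-sum : ∀ {n} (t : Fin n → ℝ) m → seq (sum t) m ≡ ℚΣ.sum λ i → seq (t i) m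
seq-sum {ℕ.zero}  t m = refl
seq-sum {ℕ.suc n} t m = cong (seq (t Fin.zero) m ℚ.+_) (seq-sum (t ∘ Fin.suc) m)

-- Tails of real sequences.

Eventually : (ℕ → Set) → Set
Eventually P = ∃ λ N → ∀ m → N ℕ.≤ m → P m

both : ∀ {P Q} → Eventually P → Eventually Q → Eventually λ m → P m × Q m
both (M , p) (N , q) = M ℕ.⊔ N , λ m m≥ →
  p m (ℕ.m⊔n≤o⇒m≤o M N m≥) , q m (ℕ.m⊔n≤o⇒n≤o M N m≥)

all : ∀ {n} {P : Fin n → ℕ → Set} → (∀ i → Eventually (P i)) → Eventually λ m → ∀ i → P i m
all {ℕ.zero}  p = 0 , λ _ _ ()
all {ℕ.suc n} p with both (p Fin.zero) (all (p ∘ Fin.suc))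
... | N , q = N , λ where
  m m≥ Fin.zero    → proj₁ (q m m≥)
  m m≥ (Fin.suc i) → proj₂ (q m m≥) i

-- Rounding to a grid.

grid-step : ∀ K {q u} → ι K ℚ.* u ℚ.≤ q → ι (ℕ.suc K) ℚ.* u ℚ.≤ q ℚ.+ u
grid-step K {q} {u} K≤q = begin
  ι (ℕ.suc K) ℚ.* u   ≡⟨ cong (ℚ._* u) (ι-suc K) ⟩
  (1ℚ ℚ.+ ι K) ℚ.* u  ≡⟨ solve 2 (λ k u → (con 1ℚ :+ k) :* u := k :* u :+ u) refl (ι K) u ⟩
  ι K ℚ.* u ℚ.+ u     ≤⟨ ℚ.+-monoˡ-≤ u K≤q ⟩
  q ℚ.+ u             ∎
  where
  open ℚ.≤-Reasoning
  open +-*-Solver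

-- Rounds `q` up to a multiple of `u` with the multiplier clamped to the range from 1 to `suc K`;
-- each alternative gives either the rounding estimate or the end of the range at which it may fail.
grid : ∀ u q K → ∃ λ a → a ℕ.≤ ℕ.suc K × 1 ℕ.≤ a ×
  (q ℚ.≤ ι a ℚ.* u ⊎ a ≡ ℕ.suc K) × (ι a ℚ.* u ℚ.≤ q ℚ.+ u ⊎ a ≡ 1)
grid u q ℕ.zero    = 1 , ℕ.≤-refl , ℕ.≤-refl , inj₂ refl , inj₂ refl
grid u q (ℕ.suc K) with ℚ.≤-total q (ι (ℕ.suc K) ℚ.* u) | grid u q K
... | inj₂ K≤q | _ =
  ℕ.suc (ℕ.suc K) , ℕ.≤-refl , ℕ.s≤s ℕ.z≤n , inj₂ refl , inj₁ (grid-step (ℕ.suc K) K≤q)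
... | inj₁ q≤K | a , a≤K , 1≤a , inj₁ q≤a , upper =
  a , ℕ.m≤n⇒m≤1+n a≤K , 1≤a , inj₁ q≤a , upper
... | inj₁ q≤K | a , a≤K , 1≤a , inj₂ refl , upper =
  a , ℕ.m≤n⇒m≤1+n a≤K , 1≤a , inj₁ q≤K , upper

-- Every late `N` is a valid sampling index, so other tail conditions can be imposed before `N` is
-- fixed.
cauchy-tail : ∀ w {u} → 0ℚ ℚ.< u → Eventually λ N → ∀ m → N ℕ.≤ m →
  seq w N ℚ.≤ seq w m ℚ.+ u × seq w m ℚ.≤ seq w N ℚ.+ u
cauchy-tail w {u} 0<u =
  let M , close = cauchy w u 0<u
      order = λ i j M≤i M≤j →
        p-q≤r⇒p≤q+r (seq w i) (seq w j) (ℚ.≤-trans (p≤∣p∣ _) (close i j M≤i M≤j))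
  in M , λ N M≤N m N≤m →
    let M≤m = ℕ.≤-trans M≤N N≤m
    in order N m M≤N M≤m , order m N M≤m M≤N

-- Here `q` is the sampled term of the sequence, `p` any later term, and `a` the multiplier obtained
-- by rounding `q + u`.
module _ {u : ℚ} (0≤u : 0ℚ ℚ.≤ u) {a : ℕ} (1≤a : 1 ℕ.≤ a) {q p : ℚ}
         (q≤p+u : q ℚ.≤ p ℚ.+ u) (p≤q+u : p ℚ.≤ q ℚ.+ u)
         (0≤p+u : 0ℚ ℚ.≤ p ℚ.+ u) where
  open ℚ.≤-Reasoning
  open +-*-Solver

  private
    1*u≡u : ι 1 ℚ.* u ≡ u
    1*u≡u = trans (cong (ℚ._* u) ι-1) (ℚ.*-identityˡ u)

  above : ∀ {K} → p ℚ.≤ ι K ℚ.* u → q ℚ.+ u ℚ.≤ ι a ℚ.* u ⊎ a ≡ K → p ℚ.≤ ι a ℚ.* u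
  above p≤K (inj₁ q≤a)  = ℚ.≤-trans p≤q+u q≤a
  above p≤K (inj₂ refl) = p≤K

  below : ℚ.- p ℚ.≤ ι a ℚ.* u
  below = begin
    ℚ.- p          ≡⟨ ℚ.+-identityˡ _ ⟨
    0ℚ ℚ.- p       ≤⟨ ℚ.+-monoˡ-≤ _ 0≤p+u ⟩
    p ℚ.+ u ℚ.- p  ≡⟨ solve 2 (λ x u → x :+ u :- x := u) refl p u ⟩
    u              ≡⟨ 1*u≡u ⟨
    ι 1 ℚ.* u      ≤⟨ *-monoʳ 0≤u (ι-mono-≤ 1≤a) ⟩
    ι a ℚ.* u      ∎

  -- The three steps `u` are the distance from `p` to `q`, the shift of the target to `q + u`, and
  -- the rounding up. If `a` was clamped to 1, `p ≥ - u` gives the same bound.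
  overshoot : ι a ℚ.* u ℚ.≤ q ℚ.+ u ℚ.+ u ⊎ a ≡ 1 → ι a ℚ.* u ℚ.≤ p ℚ.+ (u ℚ.+ u ℚ.+ u)
  overshoot (inj₁ a≤) = begin
    ι a ℚ.* u              ≤⟨ a≤ ⟩
    q ℚ.+ u ℚ.+ u          ≤⟨ ℚ.+-monoˡ-≤ u (ℚ.+-monoˡ-≤ u q≤p+u) ⟩
    p ℚ.+ u ℚ.+ u ℚ.+ u    ≡⟨ solve 2 (λ x u → x :+ u :+ u :+ u := x :+ (u :+ u :+ u)) refl p u ⟩
    p ℚ.+ (u ℚ.+ u ℚ.+ u)  ∎
  overshoot (inj₂ refl) = begin
    ι 1 ℚ.* u              ≡⟨ 1*u≡u ⟩
    u                      ≡⟨ ℚ.+-identityˡ u ⟨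
    0ℚ ℚ.+ u               ≤⟨ ℚ.+-monoˡ-≤ u 0≤p+u ⟩
    p ℚ.+ u ℚ.+ u          ≡⟨ ℚ.+-identityʳ _ ⟨
    p ℚ.+ u ℚ.+ u ℚ.+ 0ℚ   ≤⟨ ℚ.+-monoʳ-≤ (p ℚ.+ u ℚ.+ u) 0≤u ⟩
    p ℚ.+ u ℚ.+ u ℚ.+ u    ≡⟨ solve 2 (λ x u → x :+ u :+ u :+ u := x :+ (u :+ u :+ u)) refl p u ⟩
    p ℚ.+ (u ℚ.+ u ℚ.+ u)  ∎

-- Truncating at K ≥ 2/u and starting at 1 makes a * u dominate the absolute
-- value of the tail of w, so that products of tails can be compared termwise.
round : ∀ {w} → 0ℝ ≤ w → w ≤ 1ℝ → ∀ {u} → 0ℚ ℚ.< u →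
  ∀ K .{{_ : NonZero K}} → 1ℚ ℚ.+ 1ℚ ℚ.≤ ι K ℚ.* u →
  ∃ λ a → a ℕ.≤ K × Eventually λ m →
    ∣ seq w m ∣ ℚ.≤ ι a ℚ.* u × ι a ℚ.* u ℚ.≤ seq w m ℚ.+ (u ℚ.+ u ℚ.+ u)
round {w} 0≤w w≤1 {u} 0<u (ℕ.suc K) 2≤Ku =
  let 0≤u = ℚ.<⇒≤ 0<u
      -- Tolerance 1 in `w ≤ 1ℝ` bounds the tail by 2, the value that `ι K * u` has to reach.
      N , tail = both (cauchy-tail w 0<u) (both (0≤w u 0<u) (w≤1 1ℚ (ℚ.positive⁻¹ 1ℚ)))
      -- The target `q + u`, rather than `q`, lies above all later terms.
      a , a≤K , 1≤a , lower , upper = grid u (seq w N ℚ.+ u) K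
  in a , a≤K , N , λ m N≤m →
    let near = proj₁ (tail N ℕ.≤-refl) m N≤m
        _ , 0≤w+u , w≤2 = tail m N≤m
    in
    ∣p∣≤ (above 0≤u 1≤a (proj₁ near) (proj₂ near) 0≤w+u (ℚ.≤-trans w≤2 2≤Ku) lower)
          (below 0≤u 1≤a (proj₁ near) (proj₂ near) 0≤w+u) ,
    overshoot 0≤u 1≤a (proj₁ near) (proj₂ near) 0≤w+u upper

-- Absorbing additive errors into constant factors.

ι2* : ∀ p → ι 2 ℚ.* p ≡ p ℚ.+ p
ι2* p = begin
  ι 2 ℚ.* p              ≡⟨ cong (ℚ._* p) (trans (ι-+ 1 1) (cong₂ ℚ._+_ ι-1 ι-1)) ⟩
  (1ℚ ℚ.+ 1ℚ) ℚ.* p      ≡⟨ ℚ.*-distribʳ-+ p 1ℚ 1ℚ ⟩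
  1ℚ ℚ.* p ℚ.+ 1ℚ ℚ.* p  ≡⟨ cong₂ ℚ._+_ (ℚ.*-identityˡ p) (ℚ.*-identityˡ p) ⟩
  p ℚ.+ p                ∎
  where open ≡-Reasoning

ℚsum-const : ∀ n p → ℚΣ.sum {n} (λ _ → p) ≡ ι n ℚ.* p
ℚsum-const ℕ.zero    p = sym (trans (cong (ℚ._* p) ι-0) (ℚ.*-zeroˡ p))
ℚsum-const (ℕ.suc n) p = sym (begin
  ι (ℕ.suc n) ℚ.* p       ≡⟨ cong (ℚ._* p) (ι-suc n) ⟩
  (1ℚ ℚ.+ ι n) ℚ.* p      ≡⟨ ℚ.*-distribʳ-+ p 1ℚ (ι n) ⟩
  1ℚ ℚ.* p ℚ.+ ι n ℚ.* p  ≡⟨ cong₂ ℚ._+_ (ℚ.*-identityˡ p) (sym (ℚsum-const n p)) ⟩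
  p ℚ.+ ℚΣ.sum {n} (λ _ → p) ∎)
  where open ≡-Reasoning

ι-sum-* : ∀ {n} (t : Fin n → ℕ) p → ℚΣ.sum (λ i → ι (t i) ℚ.* p) ≡ ι (ℕΣ.sum t) ℚ.* p
ι-sum-* t p = sym (trans (cong (ℚ._* p) (ι-sum t)) (ℚΣ.*-distribʳ-sum p (ι ∘ t)))

+-cancelʳ-≤ : ∀ r {p q} → p ℚ.+ r ℚ.≤ q ℚ.+ r → p ℚ.≤ q
+-cancelʳ-≤ r {p} {q} p+r≤q+r = subst₂ ℚ._≤_ (undo p) (undo q) (ℚ.+-monoˡ-≤ (ℚ.- r) p+r≤q+r)
  where
  open +-*-Solver
  undo : ∀ p → p ℚ.+ r ℚ.- r ≡ p
  undo p = solve 2 (λ p r → p :+ r :- r := p) refl p r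

eventually-≤ : ∀ x y → Eventually (λ m → seq x m ℚ.≤ seq y m) → x ≤ y
eventually-≤ x y (N , x≤y) ε 0<ε = N , λ m N≤m →
  ℚ.≤-trans (x≤y m N≤m)
    (subst (ℚ._≤ seq y m ℚ.+ ε) (ℚ.+-identityʳ (seq y m)) (ℚ.+-monoʳ-≤ (seq y m) (ℚ.<⇒≤ 0<ε)))

-- Since `2δ = 1/4 ≤ α`, doubling `α ≤ s + δ` gives `2α ≤ 2s + α`, and one `α` cancels.
absorb : ∀ {α s δ} → 1ℚ ℚ.≤ ι 4 ℚ.* α → ι 8 ℚ.* δ ≡ 1ℚ → α ℚ.≤ s ℚ.+ δ → α ℚ.≤ ι 2 ℚ.* s
absorb {α} {s} {δ} 1≤4α 8δ≡1 α≤s+δ = subst (α ℚ.≤_) (sym (ι2* s)) (+-cancelʳ-≤ α (begin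
  α ℚ.+ α                  ≤⟨ ℚ.+-mono-≤ α≤s+δ α≤s+δ ⟩
  (s ℚ.+ δ) ℚ.+ (s ℚ.+ δ)  ≡⟨ solve 2 (λ s d → (s :+ d) :+ (s :+ d) := (s :+ s) :+ (d :+ d)) refl s δ ⟩
  (s ℚ.+ s) ℚ.+ (δ ℚ.+ δ)  ≤⟨ ℚ.+-monoʳ-≤ (s ℚ.+ s) 2δ≤α ⟩
  (s ℚ.+ s) ℚ.+ α          ∎))
  where
  open ℚ.≤-Reasoning
  open +-*-Solver
  2δ≤α : δ ℚ.+ δ ℚ.≤ α
  2δ≤α = ℚ.*-cancelˡ-≤-pos (ι 4)
    {{ℚ.positive (subst (ℚ._< ι 4) ι-0 (ι-mono-< {0} {4} (ℕ.s≤s ℕ.z≤n)))}} (begin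
    ι 4 ℚ.* (δ ℚ.+ δ)    ≡⟨ cong (ι 4 ℚ.*_) (ι2* δ) ⟨
    ι 4 ℚ.* (ι 2 ℚ.* δ)  ≡⟨ ℚ.*-assoc (ι 4) (ι 2) δ ⟨
    ι 4 ℚ.* ι 2 ℚ.* δ    ≡⟨ cong (ℚ._* δ) (ι-* 4 2) ⟨
    ι 8 ℚ.* δ            ≡⟨ 8δ≡1 ⟩
    1ℚ                   ≤⟨ 1≤4α ⟩
    ι 4 ℚ.* α            ∎)

-- Supplies the conjunct `0ℝ ≤ r` of `max`. Tolerance `ε/112` for `s` becomes `ε/2` after
-- multiplication by 56, and the other `ε/2` goes to the second hypothesis.
56*s≤r⇒0≤r : ∀ {r s} → 0ℝ ≤ s → fromℚ (ι 56) * s ≤ r → 0ℝ ≤ r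
56*s≤r⇒0≤r {r} {s} 0≤s Cs≤r ε 0<ε =
  let u , 0<u , 56u≡1 = ι⁻¹ 56
      0<½ε = subst (ℚ._< ½ ℚ.* ε) (ℚ.*-zeroʳ ½) (ℚ.*-monoʳ-<-pos ½ 0<ε)
      0<δ = subst (ℚ._< u ℚ.* (½ ℚ.* ε)) (ℚ.*-zeroʳ u) (ℚ.*-monoʳ-<-pos u {{ℚ.positive 0<u}} 0<½ε)
      N , large = both (0≤s (u ℚ.* (½ ℚ.* ε)) 0<δ) (Cs≤r (½ ℚ.* ε) 0<½ε)
  in N , λ m N≤m → chain u 56u≡1 m (large m N≤m)
  where
  open ℚ.≤-Reasoning
  chain : ∀ u → ι 56 ℚ.* u ≡ 1ℚ → ∀ m →
    0ℚ ℚ.≤ seq s m ℚ.+ u ℚ.* (½ ℚ.* ε) × ι 56 ℚ.* seq s m ℚ.≤ seq r m ℚ.+ ½ ℚ.* ε →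
    0ℚ ℚ.≤ seq r m ℚ.+ ε
  chain u 56u≡1 m (0≤s , Cs≤r) = begin
    0ℚ
      ≤⟨ 0≤p*q (0≤ι 56) 0≤s ⟩
    ι 56 ℚ.* (seq s m ℚ.+ u ℚ.* (½ ℚ.* ε))
      ≡⟨ solve 4 (λ c s u e → c :* (s :+ u :* e) := c :* s :+ c :* u :* e) refl (ι 56) (seq s m) u (½ ℚ.* ε) ⟩
    ι 56 ℚ.* seq s m ℚ.+ ι 56 ℚ.* u ℚ.* (½ ℚ.* ε)
      ≤⟨ ℚ.+-mono-≤ Cs≤r (ℚ.≤-reflexive (trans (cong (ℚ._* (½ ℚ.* ε)) 56u≡1) (ℚ.*-identityˡ _))) ⟩
    seq r m ℚ.+ ½ ℚ.* ε ℚ.+ ½ ℚ.* ε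
      ≡⟨ ℚ.+-assoc (seq r m) (½ ℚ.* ε) (½ ℚ.* ε) ⟩
    seq r m ℚ.+ (½ ℚ.* ε ℚ.+ ½ ℚ.* ε)
      ≡⟨ cong (seq r m ℚ.+_) (trans (sym (ℚ.*-distribʳ-+ ε ½ ½)) (ℚ.*-identityˡ ε)) ⟩
    seq r m ℚ.+ ε ∎
    where open +-*-Solver

-- X and Y are the sizes of the two sets of cells and H of the L words succeed;
-- u = 1/M and v = 1/L.
success-odds : ∀ {M L X Y H : ℕ} {u v r s : ℚ} → 0ℚ ℚ.≤ u → 0ℚ ℚ.≤ v → ι M ℚ.* u ≡ 1ℚ → ι L ℚ.* v ≡ 1ℚ →
  M ℕ.* L ℕ.≤ H ℕ.* (20 ℕ.* X ℕ.+ 4 ℕ.* Y) → 1ℚ ℚ.≤ ι 4 ℚ.* (ι X ℚ.* u) →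
  ι X ℚ.* u ℚ.≤ ι 2 ℚ.* s → ι Y ℚ.* u ℚ.≤ ι 2 ℚ.* s → ι 56 ℚ.* s ℚ.≤ r ℚ.+ 1ℚ →
  1ℚ ℚ.≤ r ℚ.* (ι H ℚ.* v)
success-odds {M} {L} {X} {Y} {H} {u} {v} {r} {s} 0≤u 0≤v Mu≡1 Lv≡1 ML≤ 1≤4x x≤2s y≤2s 56s≤r+1 = begin
  1ℚ                           ≡⟨ cong₂ ℚ._*_ Mu≡1 Lv≡1 ⟨
  (ι M ℚ.* u) ℚ.* (ι L ℚ.* v)  ≡⟨ solve 4 (λ m u l v → (m :* u) :* (l :* v) := (m :* l) :* (u :* v)) refl (ι M) u (ι L) v ⟩
  (ι M ℚ.* ι L) ℚ.* (u ℚ.* v)  ≡⟨ cong (ℚ._* (u ℚ.* v)) (ι-* M L) ⟨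
  ι (M ℕ.* L) ℚ.* (u ℚ.* v)    ≤⟨ *-monoʳ (0≤p*q 0≤u 0≤v) (ι-mono-≤ ML≤) ⟩
  ι (H ℕ.* (20 ℕ.* X ℕ.+ 4 ℕ.* Y)) ℚ.* (u ℚ.* v)
    ≡⟨ cong (ℚ._* (u ℚ.* v)) expand ⟩
  (ι H ℚ.* (ι 20 ℚ.* ι X ℚ.+ ι 4 ℚ.* ι Y)) ℚ.* (u ℚ.* v)
    ≡⟨ solve 7 (λ h a x b y u v → (h :* (a :* x :+ b :* y)) :* (u :* v) := (a :* (x :* u) :+ b :* (y :* u)) :* (h :* v))
         refl (ι H) (ι 20) (ι X) (ι 4) (ι Y) u v ⟩
  (ι 20 ℚ.* (ι X ℚ.* u) ℚ.+ ι 4 ℚ.* (ι Y ℚ.* u)) ℚ.* (ι H ℚ.* v)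
    ≤⟨ *-monoʳ (0≤p*q (0≤ι H) 0≤v) (ℚ.+-mono-≤ (*-monoˡ (0≤ι 20) x≤2s) (*-monoˡ (0≤ι 4) y≤2s)) ⟩
  (ι 20 ℚ.* (ι 2 ℚ.* s) ℚ.+ ι 4 ℚ.* (ι 2 ℚ.* s)) ℚ.* (ι H ℚ.* v)
    ≡⟨ cong (ℚ._* (ι H ℚ.* v)) collect ⟩
  ι 48 ℚ.* s ℚ.* (ι H ℚ.* v)  ≤⟨ *-monoʳ (0≤p*q (0≤ι H) 0≤v) 48s≤r ⟩
  r ℚ.* (ι H ℚ.* v)           ∎
  where
  open ℚ.≤-Reasoning
  open +-*-Solver
  expand : ι (H ℕ.* (20 ℕ.* X ℕ.+ 4 ℕ.* Y)) ≡ ι H ℚ.* (ι 20 ℚ.* ι X ℚ.+ ι 4 ℚ.* ι Y)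
  expand = trans (ι-* H _) (cong (ι H ℚ.*_) (trans (ι-+ (20 ℕ.* X) (4 ℕ.* Y)) (cong₂ ℚ._+_ (ι-* 20 X) (ι-* 4 Y))))
  scale : ∀ k l p → ι k ℚ.* (ι l ℚ.* p) ≡ ι (k ℕ.* l) ℚ.* p
  scale k l p = trans (sym (ℚ.*-assoc (ι k) (ι l) p)) (cong (ℚ._* p) (sym (ι-* k l)))
  combine : ∀ k l p → ι k ℚ.* p ℚ.+ ι l ℚ.* p ≡ ι (k ℕ.+ l) ℚ.* p
  combine k l p = trans (sym (ℚ.*-distribʳ-+ p (ι k) (ι l))) (cong (ℚ._* p) (sym (ι-+ k l)))
  collect : ι 20 ℚ.* (ι 2 ℚ.* s) ℚ.+ ι 4 ℚ.* (ι 2 ℚ.* s) ≡ ι 48 ℚ.* s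
  collect = trans (cong₂ ℚ._+_ (scale 20 2 s) (scale 4 2 s)) (combine 40 8 s)
  1≤8s : 1ℚ ℚ.≤ ι 8 ℚ.* s
  1≤8s = begin
    1ℚ                   ≤⟨ 1≤4x ⟩
    ι 4 ℚ.* (ι X ℚ.* u)  ≤⟨ *-monoˡ (0≤ι 4) x≤2s ⟩
    ι 4 ℚ.* (ι 2 ℚ.* s)  ≡⟨ scale 4 2 s ⟩
    ι 8 ℚ.* s            ∎
  -- The tolerance 1 is paid for by `8s ≥ 1`; this is the difference between 56 and 48.
  48s≤r : ι 48 ℚ.* s ℚ.≤ r
  48s≤r = +-cancelʳ-≤ (ι 8 ℚ.* s) (begin
    ι 48 ℚ.* s ℚ.+ ι 8 ℚ.* s  ≡⟨ combine 48 8 s ⟩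
    ι 56 ℚ.* s                ≤⟨ 56s≤r+1 ⟩
    r ℚ.+ 1ℚ                  ≤⟨ ℚ.+-monoʳ-≤ r 1≤8s ⟩
    r ℚ.+ ι 8 ℚ.* s           ∎)

-- Uniform distributions on lists.

𝟙≤1 : ∀ b → 𝟙 b ℕ.≤ 1
𝟙≤1 true  = ℕ.≤-refl
𝟙≤1 false = ℕ.z≤n

-- With constant weights, every term of the probability is the same rational: a count of list
-- entries times `v`.
probability-seq : ∀ {S : Set} (ws : List S) v {E : S → Set} (E? : ∀ s → Dec (E s)) m →
  seq (sum λ k → when (E? (lookup ws k)) (fromℚ v)) m ≡ ι (∑ ws λ s → 𝟙 (does (E? s))) ℚ.* v
probability-seq ws v E? m = begin
  seq (sum λ k → when (E? (lookup ws k)) (fromℚ v)) m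
    ≡⟨ seq-sum (λ k → when (E? (lookup ws k)) (fromℚ v)) m ⟩
  (ℚΣ.sum λ k → seq (when (E? (lookup ws k)) (fromℚ v)) m)
    ≡⟨ ℚΣ.sum-cong-≗ (λ k → weigh (does (E? (lookup ws k)))) ⟩
  (ℚΣ.sum λ k → ι (𝟙 (does (E? (lookup ws k)))) ℚ.* v)
    ≡⟨ ι-sum-* (λ k → 𝟙 (does (E? (lookup ws k)))) v ⟩
  ι (ℕΣ.sum λ k → 𝟙 (does (E? (lookup ws k)))) ℚ.* v
    ≡⟨ cong (λ h → ι h ℚ.* v) (∑-lookup ws (λ s → 𝟙 (does (E? s)))) ⟩
  ι (∑ ws λ s → 𝟙 (does (E? s))) ℚ.* v ∎
  where
  open ≡-Reasoning
  weigh : ∀ b → seq (if b then fromℚ v else 0ℝ) m ≡ ι (𝟙 b) ℚ.* v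
  weigh true  = sym (trans (cong (ℚ._* v) ι-1) (ℚ.*-identityˡ v))
  weigh false = sym (trans (cong (ℚ._* v) ι-0) (ℚ.*-zeroˡ v))

-- Uniform over positions of the list, so a repeated point is weighted by its multiplicity;
-- different words may induce the same strategy.
uniform : ∀ {S : Set} (ws : List S) {v} → 0ℚ ℚ.≤ v → ι (length ws) ℚ.* v ≡ 1ℚ → Distribution S
uniform ws {v} 0≤v Lv≡1 = record
  { size   = length ws
  ; point  = lookup ws
  ; weight = λ _ → fromℚ v
  ; nonneg = λ _ → eventually-≤ 0ℝ (fromℚ v) (0 , λ _ _ → 0≤v)
  ; total  = eventually-≤ Σv 1ℝ (0 , λ m _ → ℚ.≤-reflexive (total m))
           , eventually-≤ 1ℝ Σv (0 , λ m _ → ℚ.≤-reflexive (sym (total m)))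
  }
  where
  Σv : ℝ
  Σv = sum {length ws} λ _ → fromℚ v
  total : ∀ m → seq Σv m ≡ 1ℚ
  total m = trans (seq-sum {length ws} (λ _ → fromℚ v) m) (trans (ℚsum-const (length ws) v) Lv≡1)

-- The sampling protocol for a family of weights.

module _ {n : ℕ} .{{_ : NonZero n}} (f : BoolFn n) (W : Weights f) where
  open Weights W

  private
    -- The total rounding error n · 3/M of a row of weights is then 1/16.
    M : ℕ
    M = 48 ℕ.* n
    -- The height of a column, chosen so that `ι K * u = 2` as `round` requires.
    K : ℕ
    K = 2 ℕ.* M
    instance
      M-nonZero : NonZero M
      M-nonZero = ℕ.m*n≢0 48 n
      K-nonZero : NonZero K
      K-nonZero = ℕ.m*n≢0 2 M

  abstract
    step : ∃ λ u → 0ℚ ℚ.< u × ι M ℚ.* u ≡ 1ℚ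
    step = ι⁻¹ M

  private
    u : ℚ
    u = proj₁ step
    0<u : 0ℚ ℚ.< u
    0<u = proj₁ (proj₂ step)
    0≤u : 0ℚ ℚ.≤ u
    0≤u = ℚ.<⇒≤ 0<u
    Mu≡1 : ι M ℚ.* u ≡ 1ℚ
    Mu≡1 = proj₂ (proj₂ step)

  abstract
    rounded : ∀ z i → ∃ λ a → a ℕ.≤ K × Eventually λ m →
      ∣ seq (w z i) m ∣ ℚ.≤ ι a ℚ.* u × ι a ℚ.* u ℚ.≤ seq (w z i) m ℚ.+ (u ℚ.+ u ℚ.+ u)
    rounded z i = round {w z i} (0≤w z i) (w≤1 z i) 0<u K (ℚ.≤-reflexive (begin
      1ℚ ℚ.+ 1ℚ            ≡⟨ ι2* 1ℚ ⟨
      ι 2 ℚ.* 1ℚ           ≡⟨ cong (ι 2 ℚ.*_) Mu≡1 ⟨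
      ι 2 ℚ.* (ι M ℚ.* u)  ≡⟨ ℚ.*-assoc (ι 2) (ι M) u ⟨
      ι 2 ℚ.* ι M ℚ.* u    ≡⟨ cong (ℚ._* u) (ι-* 2 M) ⟨
      ι K ℚ.* u            ∎))
      where open ≡-Reasoning

  a : Domain f → Fin n → ℕ
  a z i = proj₁ (rounded z i)

  a≤K : ∀ z i → a z i ℕ.≤ K
  a≤K z i = proj₁ (proj₂ (rounded z i))

  a-tail : ∀ z → Eventually λ m → ∀ i →
    ∣ seq (w z i) m ∣ ℚ.≤ ι (a z i) ℚ.* u × ι (a z i) ℚ.* u ℚ.≤ seq (w z i) m ℚ.+ (u ℚ.+ u ℚ.+ u)
  a-tail z = all λ i → proj₂ (proj₂ (rounded z i))

  area : Domain f → ℕ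
  area z = ℕΣ.sum (a z)

  slack : ℚ
  slack = ι n ℚ.* (u ℚ.+ u ℚ.+ u)

  area-tail : ∀ z → Eventually λ m → ι (area z) ℚ.* u ℚ.≤ seq (sum (w z)) m ℚ.+ slack
  area-tail z = let N , tail = a-tail z in N , λ m N≤m → begin
    ι (area z) ℚ.* u
      ≡⟨ ι-sum-* (a z) u ⟨
    (ℚΣ.sum λ i → ι (a z i) ℚ.* u)
      ≤⟨ ℚsum-mono (λ i → proj₂ (tail m N≤m i)) ⟩
    (ℚΣ.sum λ i → seq (w z i) m ℚ.+ (u ℚ.+ u ℚ.+ u))
      ≡⟨ ℚΣ.∑-distrib-+ (λ i → seq (w z i) m) (λ _ → u ℚ.+ u ℚ.+ u) ⟩
    (ℚΣ.sum λ i → seq (w z i) m) ℚ.+ ℚΣ.sum {n} (λ _ → u ℚ.+ u ℚ.+ u)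
      ≡⟨ cong₂ ℚ._+_ (sym (seq-sum (w z) m)) (ℚsum-const n (u ℚ.+ u ℚ.+ u)) ⟩
    seq (sum (w z)) m ℚ.+ slack ∎
    where open ℚ.≤-Reasoning

  -- The product `8 * 2 * 3` is the factor 48 of `M`. Hence two slacks make up the error `1/8`
  -- allowed by `absorb`.
  8*2slack≡1 : ι 8 ℚ.* (slack ℚ.+ slack) ≡ 1ℚ
  8*2slack≡1 = begin
    ι 8 ℚ.* (slack ℚ.+ slack)
      ≡⟨ solve 3 (λ c n u → c :* (n :* (u :+ u :+ u) :+ n :* (u :+ u :+ u)) :=
                  (c :+ c :+ (c :+ c) :+ (c :+ c)) :* n :* u) refl (ι 8) (ι n) u ⟩
    (ι 8 ℚ.+ ι 8 ℚ.+ (ι 8 ℚ.+ ι 8) ℚ.+ (ι 8 ℚ.+ ι 8)) ℚ.* ι n ℚ.* u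
      ≡⟨ cong (λ c → c ℚ.* ι n ℚ.* u) (trans (cong₂ ℚ._+_ (trans (cong₂ ℚ._+_ 16≡ 16≡) (sym (ι-+ 16 16))) 16≡) (sym (ι-+ 32 16))) ⟩
    ι 48 ℚ.* ι n ℚ.* u
      ≡⟨ cong (ℚ._* u) (ι-* 48 n) ⟨
    ι M ℚ.* u
      ≡⟨ Mu≡1 ⟩
    1ℚ ∎
    where
    open ≡-Reasoning
    open +-*-Solver
    16≡ : ι 8 ℚ.+ ι 8 ≡ ι 16
    16≡ = sym (ι-+ 8 8)

  0<slack : 0ℚ ℚ.< slack
  0<slack = subst (ℚ._< slack) (ℚ.*-zeroʳ (ι n))
    (ℚ.*-monoʳ-<-pos (ι n) {{ℚ.positive (subst (ℚ._< ι n) ι-0 (ι-mono-< (ℕ.>-nonZero⁻¹ n)))}}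
      (ℚ.+-mono-< (ℚ.+-mono-< 0<u 0<u) 0<u))

  cells : List (Fin n × ℕ)
  cells = cartesianProductWith _,_ (allFin n) (downFrom K)

  length-cells : length cells ≡ n ℕ.* K
  length-cells = trans (length-cartesianProductWith _,_ (allFin n) (downFrom K))
    (cong₂ ℕ._*_ (length-tabulate {n = n} id) (length-downFrom K))

  private instance
    cells-nonZero : NonZero (length cells)
    cells-nonZero = subst NonZero (sym length-cells) (ℕ.m*n≢0 n K)
    words-nonZero : NonZero (length (words cells (length cells)))
    words-nonZero = subst NonZero (sym (length-words cells (length cells)))
      (ℕ.m^n≢0 (length cells) (length cells))

  inside : Domain f → Fin n × ℕ → Bool
  inside z (i , t) = t <ᵇ a z i

  -- A word that misses all cells of `z` is answered by the first index, which exists because `n` is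
  -- nonzero.
  play : Domain f → List (Fin n × ℕ) → Fin n
  play z = first proj₁ (Fin.fromℕ< (ℕ.>-nonZero⁻¹ n)) (inside z)

  ∑-inside : ∀ z → ∑ cells (𝟙 ∘ inside z) ℕ.≤ area z
  ∑-inside z = begin
    ∑ cells (𝟙 ∘ inside z)
      ≡⟨ ∑-cartesianProductWith _,_ (allFin n) (downFrom K) (𝟙 ∘ inside z) ⟩
    (∑ (allFin n) λ i → ∑ (downFrom K) λ t → 𝟙 (t <ᵇ a z i))
      ≤⟨ ∑-mono (allFin n) (λ i → ∑-<ᵇ-upper K (a z i)) ⟩
    ∑ (allFin n) (a z)
      ≡⟨ ∑-tabulate id (a z) ⟩
    area z ∎
    where open ℕ.≤-Reasoning

  -- A fixed pair of inputs with different values.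

  module _ (x : Preimage f false) (y : Preimage f true) where
    private
      zx zy : Domain f
      zx = false , x
      zy = true , y

    -- The same decision as in `correct?`, so that `hits` counts the successful strategies by
    -- definition.
    h : Fin n → Fin n → ℕ
    h i j = 𝟙 (does ((i Fin.≟ j) ×-dec differ? (proj₁ x) (proj₁ y) i))

    h-diagonal : ∀ i → h i i ≡ 𝟙 (does (differ? (proj₁ x) (proj₁ y) i))
    h-diagonal i = cong (λ b → 𝟙 (b ∧ does (differ? (proj₁ x) (proj₁ y) i)))
      (dec-true (i Fin.≟ i) refl)

    h≤1 : ∀ i j → h i j ℕ.≤ 1
    h≤1 i j = 𝟙≤1 (does ((i Fin.≟ j) ×-dec differ? (proj₁ x) (proj₁ y) i))

    D : ℕ
    D = agreement proj₁ (Fin.fromℕ< (ℕ.>-nonZero⁻¹ n)) cells (inside zx) (inside zy) h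

    S : ℕ
    S = ℕΣ.sum λ i → a zx i ℕ.* a zy i ℕ.* h i i

    -- The covering condition is read at one late index `m` with tolerance `½`, which leaves a sum
    -- of at least `½`. Each product of weights is at most the product of the rounded ones, and
    -- `M * u = 1` clears the denominators.
    M²≤2S : M ℕ.* M ℕ.≤ 2 ℕ.* S
    M²≤2S = ι-cancel-≤ (begin
      ι (M ℕ.* M)
        ≡⟨ trans (ι-* M M) (sym (ℚ.*-identityʳ _)) ⟩
      ι M ℚ.* ι M ℚ.* 1ℚ
        ≤⟨ *-monoˡ (0≤p*q (0≤ι M) (0≤ι M)) 1≤2S ⟩
      ι M ℚ.* ι M ℚ.* (ι 2 ℚ.* (ι S ℚ.* (u ℚ.* u)))
        ≡⟨ solve 4 (λ m c s u → m :* m :* (c :* (s :* (u :* u))) := (m :* u) :* (m :* u) :* (c :* s)) refl (ι M) (ι 2) (ι S) u ⟩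
      (ι M ℚ.* u) ℚ.* (ι M ℚ.* u) ℚ.* (ι 2 ℚ.* ι S)
        ≡⟨ cong₂ ℚ._*_ (cong₂ ℚ._*_ Mu≡1 Mu≡1) (sym (ι-* 2 S)) ⟩
      1ℚ ℚ.* ι (2 ℕ.* S)
        ≡⟨ ℚ.*-identityˡ _ ⟩
      ι (2 ℕ.* S) ∎)
      where
      open ℚ.≤-Reasoning
      open +-*-Solver
      common : Fin n → ℝ
      common i = when (differ? (proj₁ x) (proj₁ y) i) (w zx i * w zy i)
      tails = both (covers zx zy refl ½ (ℚ.positive⁻¹ ½)) (both (a-tail zx) (a-tail zy))
      m = proj₁ tails
      at-m = proj₂ tails m ℕ.≤-refl
      common≤ : ∀ i → seq (common i) m ℚ.≤ ι (a zx i ℕ.* a zy i ℕ.* h i i) ℚ.* (u ℚ.* u)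
      common≤ i rewrite h-diagonal i with does (differ? (proj₁ x) (proj₁ y) i)
      ... | false = 0≤p*q (0≤ι (a zx i ℕ.* a zy i ℕ.* 0)) (0≤p*q 0≤u 0≤u)
      ... | true  = begin
        -- Terms of a nonnegative real may be negative, so the factors are bounded through their
        -- absolute values.
        p ℚ.* q                          ≤⟨ p≤∣p∣ (p ℚ.* q) ⟩
        ∣ p ℚ.* q ∣                      ≡⟨ ℚ.∣p*q∣≡∣p∣*∣q∣ p q ⟩
        ∣ p ∣ ℚ.* ∣ q ∣                  ≤⟨ *-monoʳ (ℚ.0≤∣p∣ q) (proj₁ (proj₁ (proj₂ at-m) i)) ⟩
        (ι b ℚ.* u) ℚ.* ∣ q ∣            ≤⟨ *-monoˡ (0≤p*q (0≤ι b) 0≤u) (proj₁ (proj₂ (proj₂ at-m) i)) ⟩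
        (ι b ℚ.* u) ℚ.* (ι c ℚ.* u)      ≡⟨ solve 3 (λ b c u → (b :* u) :* (c :* u) := (b :* c) :* (u :* u)) refl (ι b) (ι c) u ⟩
        (ι b ℚ.* ι c) ℚ.* (u ℚ.* u)      ≡⟨ cong (ℚ._* (u ℚ.* u)) (ι-* b c) ⟨
        ι (b ℕ.* c) ℚ.* (u ℚ.* u)        ≡⟨ cong (λ k → ι k ℚ.* (u ℚ.* u)) (ℕ.*-identityʳ (b ℕ.* c)) ⟨
        ι (b ℕ.* c ℕ.* 1) ℚ.* (u ℚ.* u)  ∎
        where
        p = seq (w zx i) m
        q = seq (w zy i) m
        b = a zx i
        c = a zy i
      ½≤S : ½ ℚ.≤ ι S ℚ.* (u ℚ.* u)
      ½≤S = +-cancelʳ-≤ ½ (begin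
        1ℚ                        ≤⟨ proj₁ at-m ⟩
        seq (sum common) m ℚ.+ ½  ≡⟨ cong (ℚ._+ ½) (seq-sum common m) ⟩
        (ℚΣ.sum λ i → seq (common i) m) ℚ.+ ½
          ≤⟨ ℚ.+-monoˡ-≤ ½ (ℚsum-mono common≤) ⟩
        (ℚΣ.sum λ i → ι (a zx i ℕ.* a zy i ℕ.* h i i) ℚ.* (u ℚ.* u)) ℚ.+ ½
          ≡⟨ cong (ℚ._+ ½) (ι-sum-* (λ i → a zx i ℕ.* a zy i ℕ.* h i i) (u ℚ.* u)) ⟩
        ι S ℚ.* (u ℚ.* u) ℚ.+ ½  ∎)
      1≤2S : 1ℚ ℚ.≤ ι 2 ℚ.* (ι S ℚ.* (u ℚ.* u))
      1≤2S = subst (1ℚ ℚ.≤_) (sym (ι2* _)) (ℚ.+-mono-≤ ½≤S ½≤S)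

    -- Column by column, `*≤∑-<ᵇ` trades the product of two heights for `K` times the number of
    -- common cells; `D` adds these up over the columns where `x` and `y` differ.
    S≤DK : S ℕ.≤ D ℕ.* K
    S≤DK = begin
      S
        ≡⟨ ∑-tabulate id (λ i → a zx i ℕ.* a zy i ℕ.* h i i) ⟨
      (∑ (allFin n) λ i → a zx i ℕ.* a zy i ℕ.* h i i)
        ≤⟨ ∑-mono (allFin n) column ⟩
      (∑ (allFin n) λ i → (∑ (downFrom K) λ t → g i t) ℕ.* K)
        ≡⟨ ∑-distribʳ-* (allFin n) (λ i → ∑ (downFrom K) (g i)) K ⟩
      (∑ (allFin n) λ i → ∑ (downFrom K) λ t → g i t) ℕ.* K
        ≡⟨ cong (ℕ._* K) (∑-cartesianProductWith _,_ (allFin n) (downFrom K) λ (i , t) → g i t) ⟨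
      D ℕ.* K ∎
      where
      open ℕ.≤-Reasoning
      g : Fin n → ℕ → ℕ
      g i t = 𝟙 (t <ᵇ a zx i) ℕ.* 𝟙 (t <ᵇ a zy i) ℕ.* h i i
      column : ∀ i → a zx i ℕ.* a zy i ℕ.* h i i ℕ.≤ ∑ (downFrom K) (g i) ℕ.* K
      column i = begin
        a zx i ℕ.* a zy i ℕ.* h i i
          ≤⟨ ℕ.*-monoˡ-≤ (h i i) (*≤∑-<ᵇ K (a≤K zx i) (a≤K zy i)) ⟩
        m ℕ.* K ℕ.* h i i
          ≡⟨ ℕ-Solver.solve 3 (λ m k h → m ℕ-Solver.:* k ℕ-Solver.:* h ℕ-Solver.:= m ℕ-Solver.:* h ℕ-Solver.:* k) refl m K (h i i) ⟩
        m ℕ.* h i i ℕ.* K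
          ≡⟨ cong (ℕ._* K) (∑-distribʳ-* (downFrom K) _ (h i i)) ⟨
        ∑ (downFrom K) (g i) ℕ.* K ∎
        where
        m = ∑ (downFrom K) λ t → 𝟙 (t <ᵇ a zx i) ℕ.* 𝟙 (t <ᵇ a zy i)

    M≤4D : M ℕ.≤ 4 ℕ.* D
    M≤4D = ℕ.*-cancelʳ-≤ M (4 ℕ.* D) M (begin
      M ℕ.* M                  ≤⟨ M²≤2S ⟩
      2 ℕ.* S                  ≤⟨ ℕ.*-monoʳ-≤ 2 S≤DK ⟩
      2 ℕ.* (D ℕ.* (2 ℕ.* M))  ≡⟨ solve 2 (λ d m → con 2 :* (d :* (con 2 :* m)) := con 4 :* d :* m) refl D M ⟩
      4 ℕ.* D ℕ.* M            ∎)
      where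
      open ℕ.≤-Reasoning
      open ℕ-Solver

    D≤area-y : D ℕ.≤ area zy
    D≤area-y = ℕ.≤-trans (∑-mono cells λ c → begin
      p c ℕ.* q c ℕ.* h (proj₁ c) (proj₁ c)  ≤⟨ ℕ.*-mono-≤ (ℕ.*-monoˡ-≤ (q c) (𝟙≤1 (inside zx c))) (h≤1 (proj₁ c) (proj₁ c)) ⟩
      1 ℕ.* q c ℕ.* 1                        ≡⟨ trans (ℕ.*-identityʳ _) (ℕ.*-identityˡ _) ⟩
      q c                                    ∎) (∑-inside zy)
      where
      open ℕ.≤-Reasoning
      p q : Fin n × ℕ → ℕ
      p = 𝟙 ∘ inside zx
      q = 𝟙 ∘ inside zy

    D≤area-x : D ℕ.≤ area zx
    D≤area-x = ℕ.≤-trans (∑-mono cells λ c → begin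
      p c ℕ.* q c ℕ.* h (proj₁ c) (proj₁ c)  ≤⟨ ℕ.*-mono-≤ (ℕ.*-monoʳ-≤ (p c) (𝟙≤1 (inside zy c))) (h≤1 (proj₁ c) (proj₁ c)) ⟩
      p c ℕ.* 1 ℕ.* 1                        ≡⟨ trans (ℕ.*-identityʳ _) (ℕ.*-identityʳ _) ⟩
      p c                                    ∎) (∑-inside zx)
      where
      open ℕ.≤-Reasoning
      p q : Fin n × ℕ → ℕ
      p = 𝟙 ∘ inside zx
      q = 𝟙 ∘ inside zy

    H : ℕ
    H = hits proj₁ (Fin.fromℕ< (ℕ.>-nonZero⁻¹ n)) cells (inside zx) (inside zy) h (length cells)

    L : ℕ
    L = length (words cells (length cells))

    -- The cells counted by `D` belong to both inputs, so each rounded total weight is at least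
    -- `1/4`. This lower bound is what allows additive errors to be absorbed.
    M≤4·area-x : M ℕ.≤ 4 ℕ.* area zx
    M≤4·area-x = ℕ.≤-trans M≤4D (ℕ.*-monoʳ-≤ 4 D≤area-x)

    M≤4·area-y : M ℕ.≤ 4 ℕ.* area zy
    M≤4·area-y = ℕ.≤-trans M≤4D (ℕ.*-monoʳ-≤ 4 D≤area-y)

    -- The summand 1 of `hits-length` is absorbed into `4 * area zx`; with the factor 4 of `M≤4D`
    -- this gives `20 = 4 * (4 + 1)` and 4.
    ML≤ : M ℕ.* L ℕ.≤ H ℕ.* (20 ℕ.* area zx ℕ.+ 4 ℕ.* area zy)
    ML≤ = begin
      M ℕ.* L
        ≤⟨ ℕ.*-monoˡ-≤ L M≤4D ⟩
      4 ℕ.* D ℕ.* L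
        ≡⟨ trans (ℕ.*-assoc 4 D L) (cong (λ l → 4 ℕ.* (D ℕ.* l)) (length-words cells (length cells))) ⟩
      4 ℕ.* (D ℕ.* length cells ℕ.^ length cells)
        ≤⟨ ℕ.*-monoʳ-≤ 4 (hits-length proj₁ _ cells (inside zx) (inside zy) h) ⟩
      4 ℕ.* (H ℕ.* (1 ℕ.+ (∑ cells (𝟙 ∘ inside zx) ℕ.+ ∑ cells (𝟙 ∘ inside zy))))
        ≤⟨ ℕ.*-monoʳ-≤ 4 (ℕ.*-monoʳ-≤ H (ℕ.+-mono-≤ 1≤4·area-x (ℕ.+-mono-≤ (∑-inside zx) (∑-inside zy)))) ⟩
      4 ℕ.* (H ℕ.* (4 ℕ.* area zx ℕ.+ (area zx ℕ.+ area zy)))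
        ≡⟨ solve 3 (λ h x y → con 4 :* (h :* (con 4 :* x :+ (x :+ y))) := h :* (con 20 :* x :+ con 4 :* y)) refl H (area zx) (area zy) ⟩
      H ℕ.* (20 ℕ.* area zx ℕ.+ 4 ℕ.* area zy) ∎
      where
      open ℕ.≤-Reasoning
      open ℕ-Solver
      1≤4·area-x : 1 ℕ.≤ 4 ℕ.* area zx
      1≤4·area-x = ℕ.≤-trans (ℕ.>-nonZero⁻¹ M) M≤4·area-x

  -- Assembling the bound.

  1≤4α : ∀ z → M ℕ.≤ 4 ℕ.* area z → 1ℚ ℚ.≤ ι 4 ℚ.* (ι (area z) ℚ.* u)
  1≤4α z M≤4·area = begin
    1ℚ                          ≡⟨ Mu≡1 ⟨
    ι M ℚ.* u                   ≤⟨ *-monoʳ 0≤u (ι-mono-≤ M≤4·area) ⟩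
    ι (4 ℕ.* area z) ℚ.* u      ≡⟨ cong (ℚ._* u) (ι-* 4 (area z)) ⟩
    ι 4 ℚ.* ι (area z) ℚ.* u    ≡⟨ ℚ.*-assoc (ι 4) (ι (area z)) u ⟩
    ι 4 ℚ.* (ι (area z) ℚ.* u)  ∎
    where open ℚ.≤-Reasoning

  -- Rounding costs one `slack` and the comparison of the row sum with `s` another; `absorb` turns
  -- the total into the factor 2.
  α≤2s : ∀ z → M ℕ.≤ 4 ℕ.* area z → ∀ s → sum (w z) ≤ s →
    Eventually λ m → ι (area z) ℚ.* u ℚ.≤ ι 2 ℚ.* seq s m
  α≤2s z M≤4·area s Σw≤s =
    let N , tail = both (area-tail z) (Σw≤s slack 0<slack)
    in N , λ m N≤m → absorb {s = seq s m} (1≤4α z M≤4·area) 8*2slack≡1 (begin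
      ι (area z) ℚ.* u               ≤⟨ proj₁ (tail m N≤m) ⟩
      seq (sum (w z)) m ℚ.+ slack    ≤⟨ ℚ.+-monoˡ-≤ slack (proj₂ (tail m N≤m)) ⟩
      seq s m ℚ.+ slack ℚ.+ slack    ≡⟨ ℚ.+-assoc (seq s m) slack slack ⟩
      seq s m ℚ.+ (slack ℚ.+ slack)  ∎)
    where open ℚ.≤-Reasoning

  -- The public coin is a uniform word with as many letters as there are cells, and each word fixes
  -- a pair of deterministic strategies. From some index on, `success-odds` gives the required
  -- inequality term by term.
  CGpub-bound : ∀ r s → 0ℝ ≤ s → (∀ z → sum (w z) ≤ s) → fromℚ (ι 56) * s ≤ r → CGpub f r
  CGpub-bound r s 0≤s Σw≤s 56s≤r =
    uniform strategies 0≤v Lv≡1 , 56*s≤r⇒0≤r {r} {s} 0≤s 56s≤r , λ (x , y) →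
    let zx = false , x
        zy = true , y
        N , tail = both (both (α≤2s zx (M≤4·area-x x y) s (Σw≤s zx)) (α≤2s zy (M≤4·area-y x y) s (Σw≤s zy)))
                        (56s≤r 1ℚ (ℚ.positive⁻¹ 1ℚ))
    in eventually-≤ 1ℝ (r * probability (uniform strategies 0≤v Lv≡1) (correct? f x y)) (N , λ m N≤m →
      let (x≤2s , y≤2s) , 56s≤r+1 = tail m N≤m in
      subst (λ P → 1ℚ ℚ.≤ seq r m ℚ.* P)
        (sym (trans (probability-seq strategies v (correct? f x y) m)
          (cong (λ k → ι k ℚ.* v) (∑-map strategy ws λ s → 𝟙 (does (correct? f x y s))))))
        (success-odds {X = area zx} {Y = area zy} {r = seq r m} 0≤u 0≤v Mu≡1 (proj₂ (proj₂ inverse)) (ML≤ x y)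
          (1≤4α zx (M≤4·area-x x y)) x≤2s y≤2s 56s≤r+1))
    where
    strategy : List (Fin n × ℕ) → Strategy f
    strategy word = (λ x → play (false , x) word) , (λ y → play (true , y) word)
    ws = words cells (length cells)
    strategies = map strategy ws
    inverse : ∃ λ v → 0ℚ ℚ.< v × ι (length ws) ℚ.* v ≡ 1ℚ
    inverse = ι⁻¹ (length ws)
    v = proj₁ inverse
    0≤v : 0ℚ ℚ.≤ v
    0≤v = ℚ.<⇒≤ (proj₁ (proj₂ inverse))
    Lv≡1 : ι (length strategies) ℚ.* v ≡ 1ℚ
    Lv≡1 = trans (cong (λ l → ι l ℚ.* v) (length-map strategy ws)) (proj₂ (proj₂ inverse))

theorem5p5 : ∃ λ (C : ℝ) → 0ℝ < C × (∀ (n : ℕ) → .{{_ : NonZero n}} → (f : BoolFn n) → CGpub f ≤∞ C · EC f)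
theorem5p5 = fromℚ (ι 56)
  , (ι 56 , subst (ℚ._< ι 56) ι-0 (ι-mono-< {0} {56} (ℕ.s≤s ℕ.z≤n)) , 0 , λ _ _ → ℚ.≤-reflexive (ℚ.+-identityˡ (ι 56)))
  -- A bound `r` of `C · EC f` unfolds to weights `W` whose row sums are at most some `s` with
  -- `56s ≤ r`.
  , λ n f r (s , (W , 0≤s , Σw≤s) , 56s≤r) → CGpub-bound f W r s 0≤s Σw≤s 56s≤r
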